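{- Let $n\ge 1$, let $q_1,\ldots,q_n\ge 2$ be integers, let $V=[q_1]\times\cdots\times[q_n]$, and let $t$ be an integer with $0\le t\le n$. A nonempty (finite) multiset $C$ of elements of $V$ is an orthogonal array $\mathrm{OA}(|C|,q_1\cdot q_2\cdot\ldots\cdot q_n,t)$ if and only if $C$ is an algebraic $t$-design in the multigraph $H(q_1\cdot q_2\cdot\ldots\cdot q_n)$.
   Context: For a positive integer $s$, $[s]=\{0,\ldots,s-1\}$. Graphs are multigraphs; the adjacency matrix $A$ of a graph with vertex set $V$ has $A_{x,y}$ equal to the multiplicity of the edge $\{x,y\}$. Eigenfunctions of the graph are eigenvectors of $A$ viewed as functions $V\to\mathbb{C}$; the eigenspace of an eigenvalue $\theta$ is the set of all $f:V\to\mathbb C$ with $Af=\theta f$. The graph $H(q_1\cdot\ldots\cdot q_n)$ has vertex set $V=[q_1]\times\cdots\times[q_n]$; two $n$-tuples are joined by an edge of multiplicity $Q/q_i$ if they differ in exactly one position, namely the $i$th, where $Q=\mathrm{lcm}(q_1,\ldots,q_n)$; all other pairs are non-adjacent. Its distinct eigenvalues are $\theta_w=k-wQ$, $w=0,\ldots,n$, where $k=\sum_{i=1}^n\frac{Q}{q_i}(q_i-1)$ is its degree. Algebraic $t$-design: for a regular graph with distinct eigenvalues $\theta_0>\theta_1>\ldots>\theta_d$ and corresponding eigenspaces $S_0,\ldots,S_d$, a multiset $C$ of vertices is an algebraic $t$-design if in the decomposition $f_C=\varphi_0+\varphi_1+\cdots+\varphi_d$, $\varphi_i\in S_i$, of its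 multiplicity function $f_C$ one has $\varphi_1=\cdots=\varphi_t\equiv 0$. Orthogonal array: a nonempty multiset $C$ of elements of $V$ is an orthogonal array of strength $t$, denoted $\mathrm{OA}(|C|,q_1\cdot\ldots\cdot q_n,t)$, if for any distinct $i_1,\ldots,i_t\in\{1,\ldots,n\}$ and any $a_j\in[q_{i_j}]$, $j=1,\ldots,t$, the number (counted with multiplicity) of $(x_1,\ldots,x_n)\in C$ with $x_{i_j}=a_j$ for all $j=1,\ldots,t$ equals $|C|/(q_{i_1}\cdots q_{i_t})$. Cardinalities of multisets count multiplicities. -}

module Defs where

open import Level using (0ℓ)
open import Algebra.Bundles using (CommutativeRing)
import Algebra.Definitions.RawMonoid as RawMonoidDefinitions
open import Data.Empty using (⊥-elim)
open import Data.Fin as Fin using (Fin; toℕ)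
open import Data.Fin.Properties as Fin using (all?; any?)
open import Data.Integer as ℤ using (ℤ; +_; -[1+_])
open import Data.List as List using (List; []; _∷_; allFin; cartesianProductWith; filter; foldr)
open import Data.List.Membership.Propositional using (_∈_)
open import Data.List.Membership.Propositional.Properties using (∈-allFin; ∈-cartesianProductWith⁺)
open import Data.List.Relation.Unary.Any using (here)
import Data.List.Relation.Unary.All as ListAll
import Data.List.Relation.Unary.AllPairs as AllPairs
open import Data.List.Relation.Unary.Unique.Propositional using (Unique)
open import Data.List.Relation.Unary.Unique.Propositional.Properties using (allFin⁺; cartesianProductWith⁺)
open import Data.Nat as ℕ using (ℕ; suc)
open import Data.Nat.Divisibility using (_∣_; quotient; ∣-trans)
open import Data.Nat.LCM using (lcm; m∣lcm[m,n]; n∣lcm[m,n])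
import Data.Nat.Properties as ℕ
open import Data.Product using (Σ-syntax; ∃-syntax; _×_; _,_)
open import Data.Rational as ℚ using (ℚ; 0ℚ; 1ℚ; ½; ∣_∣; Positive; NonNegative)
import Data.Rational.Properties as ℚ
open import Data.Vec as Vec using (Vec; lookup)
open import Data.Vec.Relation.Unary.All using (All; []; _∷_)
open import Data.Vec.Relation.Unary.All.Properties using (lookup⁺)
open import Function.Definitions using (Injective)
open import Relation.Binary using (IsEquivalence)
open import Relation.Binary.PropositionalEquality using (_≡_; _≢_; refl; sym; trans; cong; subst)
open import Relation.Nullary using (Dec; yes; no; ¬?)
open import Relation.Nullary.Decidable using (dec⇒maybe; _×-dec_; _→-dec_)
open import Tactic.RingSolver using (solve-∀)
open import Tactic.RingSolver.Core.AlmostCommutativeRing using (AlmostCommutativeRing; fromCommutativeRing)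

-- The real numbers are the Cauchy sequences of rationals.  Two sequences are
-- related by _∼_ when all their late terms are close to each other, so s ∼ s
-- says that s is a Cauchy sequence and, between Cauchy sequences, _∼_ says that
-- the difference tends to 0.

infix 4 _∼_

_∼_ : (ℕ → ℚ) → (ℕ → ℚ) → Set
s ∼ s′ = ∀ ε .{{_ : Positive ε}} →
  ∃[ N ] (∀ m n → N ℕ.≤ m → N ℕ.≤ n → ∣ s m ℚ.- s′ n ∣ ℚ.≤ ε)

record ℝ : Set where
  no-eta-equality
  field
    seq    : ℕ → ℚ
    cauchy : seq ∼ seq

open ℝ public

infix 4 _≃_

record _≃_ (x y : ℝ) : Set where
  no-eta-equality
  constructor mk≃
  field
    close : seq x ∼ seq y

open _≃_ public

private

  module Identities where

    open import Data.Rational using (_+_; _*_; -_; _-_)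

    ℚ-ring : AlmostCommutativeRing 0ℓ 0ℓ
    ℚ-ring = fromCommutativeRing ℚ.+-*-commutativeRing (λ x → dec⇒maybe (0ℚ ℚ.≟ x))

    flip : ∀ a b → - (a - b) ≡ b - a
    flip = solve-∀ ℚ-ring

    telescope : ∀ a b c → a - c ≡ (a - b) + (b - c)
    telescope = solve-∀ ℚ-ring

    rearrange : ∀ a a′ b b′ → (a + b) - (a′ + b′) ≡ (a - a′) + (b - b′)
    rearrange = solve-∀ ℚ-ring

    neg-sub : ∀ a b → - (a - b) ≡ (- a) - (- b)
    neg-sub = solve-∀ ℚ-ring

    cancel : ∀ a b → a ≡ (a - b) + b
    cancel = solve-∀ ℚ-ring

    collect : ∀ A B r ε → A * (r * ε) + (r * ε) * B ≡ ((A + B) * r) * ε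
    collect = solve-∀ ℚ-ring

    expand : ∀ a a′ b b′ → a * b - a′ * b′ ≡ a * (b - b′) + (a - a′) * b′
    expand = solve-∀ ℚ-ring

    assoc-re : ∀ a b c d e f → (a * c - b * d) * e - (a * d + b * c) * f ≡ a * (c * e - d * f) - b * (c * f + d * e)
    assoc-re = solve-∀ ℚ-ring

    assoc-im : ∀ a b c d e f → (a * c - b * d) * f + (a * d + b * c) * e ≡ a * (c * f + d * e) + b * (c * e - d * f)
    assoc-im = solve-∀ ℚ-ring

    distrib-re : ∀ a b c d e f → a * (c + e) - b * (d + f) ≡ (a * c - b * d) + (a * e - b * f)
    distrib-re = solve-∀ ℚ-ring

    distrib-im : ∀ a b c d e f → a * (d + f) + b * (c + e) ≡ (a * d + b * c) + (a * f + b * e)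
    distrib-im = solve-∀ ℚ-ring

    identity-re : ∀ a b → 1ℚ * a - 0ℚ * b ≡ a
    identity-re = solve-∀ ℚ-ring

    identity-im : ∀ a b → 1ℚ * b + 0ℚ * a ≡ b
    identity-im = solve-∀ ℚ-ring

    comm-re : ∀ a b c d → a * c - b * d ≡ c * a - d * b
    comm-re = solve-∀ ℚ-ring

    comm-im : ∀ a b c d → a * d + b * c ≡ c * b + d * a
    comm-im = solve-∀ ℚ-ring

  open Identities

  triangle : ∀ {a b c δ ε} → c ≡ a ℚ.+ b → ∣ a ∣ ℚ.≤ δ → ∣ b ∣ ℚ.≤ ε → ∣ c ∣ ℚ.≤ δ ℚ.+ ε
  triangle {a} {b} refl p q = ℚ.≤-trans (ℚ.∣p+q∣≤∣p∣+∣q∣ a b) (ℚ.+-mono-≤ p q)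

  halve : ∀ ε → ½ ℚ.* ε ℚ.+ ½ ℚ.* ε ≡ ε
  halve ε = trans (sym (ℚ.*-distribʳ-+ ε ½ ½)) (ℚ.*-identityˡ ε)

  half-pos : ∀ ε .{{_ : Positive ε}} → Positive (½ ℚ.* ε)
  half-pos ε = ℚ.pos*pos⇒pos ½ ε

  split : ∀ {a b c ε} → c ≡ a ℚ.+ b → ∣ a ∣ ℚ.≤ ½ ℚ.* ε → ∣ b ∣ ℚ.≤ ½ ℚ.* ε → ∣ c ∣ ℚ.≤ ε
  split {a} {b} {c} {ε} e p q = subst (∣ c ∣ ℚ.≤_) (halve ε) (triangle {a} {b} e p q)

  ⊔ˡ : ∀ M N {m} → M ℕ.⊔ N ℕ.≤ m → M ℕ.≤ m
  ⊔ˡ M N p = ℕ.≤-trans (ℕ.m≤m⊔n M N) p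

  ⊔ʳ : ∀ M N {m} → M ℕ.⊔ N ℕ.≤ m → N ℕ.≤ m
  ⊔ʳ M N p = ℕ.≤-trans (ℕ.m≤n⊔m M N) p

  ∼-sym : ∀ {s s′} → s ∼ s′ → s′ ∼ s
  ∼-sym {s} {s′} p ε with p ε
  ... | N , h = N , λ m n N≤m N≤n →
    subst (ℚ._≤ ε) (trans (sym (ℚ.∣-p∣≡∣p∣ (s n ℚ.- s′ m))) (cong ∣_∣ (flip (s n) (s′ m)))) (h n m N≤n N≤m)

  ∼-trans : ∀ {s s′ s″} → s ∼ s′ → s′ ∼ s″ → s ∼ s″
  ∼-trans {s} {s′} {s″} p q ε with p (½ ℚ.* ε) {{half-pos ε}} | q (½ ℚ.* ε) {{half-pos ε}}
  ... | M , f | N , g = M ℕ.⊔ N , λ m n m≥ n≥ →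
    split {s m ℚ.- s′ n} {s′ n ℚ.- s″ n} (telescope (s m) (s′ n) (s″ n)) (f m n (⊔ˡ M N m≥) (⊔ˡ M N n≥)) (g n n (⊔ʳ M N n≥) (⊔ʳ M N n≥))

  ∼-pointwise : ∀ {s s′} → s ∼ s → (∀ n → s n ≡ s′ n) → s ∼ s′
  ∼-pointwise {s} p e ε with p ε
  ... | N , h = N , λ m n N≤m N≤n → subst (λ z → ∣ s m ℚ.- z ∣ ℚ.≤ ε) (e n) (h m n N≤m N≤n)

  ∼-const : ∀ c → (λ _ → c) ∼ (λ _ → c)
  ∼-const c ε = 0 , λ _ _ _ _ → subst (λ z → ∣ z ∣ ℚ.≤ ε) (sym (ℚ.+-inverseʳ c)) (ℚ.<⇒≤ (ℚ.positive⁻¹ ε))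

  +-∼ : ∀ {a a′ b b′} → a ∼ a′ → b ∼ b′ → (λ n → a n ℚ.+ b n) ∼ (λ n → a′ n ℚ.+ b′ n)
  +-∼ {a} {a′} {b} {b′} p q ε with p (½ ℚ.* ε) {{half-pos ε}} | q (½ ℚ.* ε) {{half-pos ε}}
  ... | M , f | N , g = M ℕ.⊔ N , λ m n m≥ n≥ →
    split {a m ℚ.- a′ n} {b m ℚ.- b′ n} (rearrange (a m) (a′ n) (b m) (b′ n)) (f m n (⊔ˡ M N m≥) (⊔ˡ M N n≥)) (g m n (⊔ʳ M N m≥) (⊔ʳ M N n≥))

  neg-∼ : ∀ {a a′} → a ∼ a′ → (λ n → ℚ.- a n) ∼ (λ n → ℚ.- a′ n)
  neg-∼ {a} {a′} p ε with p ε
  ... | N , h = N , λ m n N≤m N≤n →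
    subst (ℚ._≤ ε) (trans (sym (ℚ.∣-p∣≡∣p∣ (a m ℚ.- a′ n))) (cong ∣_∣ (neg-sub (a m) (a′ n)))) (h m n N≤m N≤n)

  Bounded : ℚ → (ℕ → ℚ) → Set
  Bounded B a = ∃[ N ] (∀ m → N ℕ.≤ m → ∣ a m ∣ ℚ.≤ B)

  eventuallyBounded : ∀ {a a′} → a ∼ a′ → Σ[ B ∈ ℚ ] Positive B × Bounded B a
  eventuallyBounded {a} {a′} p with p 1ℚ
  ... | N , h =
    1ℚ ℚ.+ ∣ a′ N ∣
    , ℚ.pos+nonNeg⇒pos 1ℚ ∣ a′ N ∣ {{ℚ.∣-∣-nonNeg (a′ N)}}
    , N , λ m N≤m → triangle {a m ℚ.- a′ N} {a′ N} (cancel (a m) (a′ N)) (h m N N≤m ℕ.≤-refl) ℚ.≤-refl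

  product-bound : ∀ {a b δ ε} → .{{NonNegative δ}} → ∣ a ∣ ℚ.≤ δ → ∣ b ∣ ℚ.≤ ε → ∣ a ℚ.* b ∣ ℚ.≤ δ ℚ.* ε
  product-bound {a} {b} {δ} {ε} p q = begin
    ∣ a ℚ.* b ∣      ≡⟨ ℚ.∣p*q∣≡∣p∣*∣q∣ a b ⟩
    ∣ a ∣ ℚ.* ∣ b ∣  ≤⟨ ℚ.*-monoʳ-≤-nonNeg ∣ b ∣ {{ℚ.∣-∣-nonNeg b}} p ⟩
    δ ℚ.* ∣ b ∣      ≤⟨ ℚ.*-monoˡ-≤-nonNeg δ q ⟩
    δ ℚ.* ε          ∎
    where open ℚ.≤-Reasoning

  -- Given positive A, B and ε, a positive δ with A δ + δ B = ε.
  share : ∀ A B ε → Positive A → Positive B → Positive ε →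
    Σ[ δ ∈ ℚ ] Positive δ × A ℚ.* δ ℚ.+ δ ℚ.* B ≡ ε
  share A B ε A>0 B>0 ε>0 = combine (ℚ.1/_ (A ℚ.+ B) {{A+B≢0}})
      (ℚ.1/pos⇒pos (A ℚ.+ B) {{A+B>0}}) (ℚ.*-inverseʳ (A ℚ.+ B) {{A+B≢0}})
    where
    A+B>0 : Positive (A ℚ.+ B)
    A+B>0 = ℚ.pos+nonNeg⇒pos A {{A>0}} B {{ℚ.pos⇒nonNeg B {{B>0}}}}

    A+B≢0 : ℚ.NonZero (A ℚ.+ B)
    A+B≢0 = ℚ.pos⇒nonZero (A ℚ.+ B) {{A+B>0}}

    combine : ∀ r → Positive r → (A ℚ.+ B) ℚ.* r ≡ 1ℚ → Σ[ δ ∈ ℚ ] Positive δ × A ℚ.* δ ℚ.+ δ ℚ.* B ≡ ε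
    combine r r>0 e = r ℚ.* ε , ℚ.pos*pos⇒pos r {{r>0}} ε {{ε>0}}
      , trans (collect A B r ε) (trans (cong (ℚ._* ε) e) (ℚ.*-identityˡ ε))

  *-bound : ∀ {A B δ ε a a′ b b′} → Positive A → Positive δ → A ℚ.* δ ℚ.+ δ ℚ.* B ≡ ε →
    ∣ a ∣ ℚ.≤ A → ∣ b′ ∣ ℚ.≤ B → ∣ a ℚ.- a′ ∣ ℚ.≤ δ → ∣ b ℚ.- b′ ∣ ℚ.≤ δ →
    ∣ a ℚ.* b ℚ.- a′ ℚ.* b′ ∣ ℚ.≤ ε
  *-bound {A} {B} {δ} {ε} {a} {a′} {b} {b′} A>0 δ>0 refl a≤ b′≤ a-a′≤ b-b′≤ =
    triangle {a ℚ.* (b ℚ.- b′)} {(a ℚ.- a′) ℚ.* b′} (expand a a′ b b′)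
      (product-bound {a} {b ℚ.- b′} {{ℚ.pos⇒nonNeg A {{A>0}}}} a≤ b-b′≤)
      (product-bound {a ℚ.- a′} {b′} {{ℚ.pos⇒nonNeg δ {{δ>0}}}} a-a′≤ b′≤)

  Close : ℚ → (ℕ → ℚ) → (ℕ → ℚ) → Set
  Close ε s s′ = ∃[ N ] (∀ m n → N ℕ.≤ m → N ℕ.≤ n → ∣ s m ℚ.- s′ n ∣ ℚ.≤ ε)

  *-close : ∀ {A B δ ε} a a′ b b′ → Positive A → Positive δ → A ℚ.* δ ℚ.+ δ ℚ.* B ≡ ε →
    Bounded A a → Bounded B b′ → Close δ a a′ → Close δ b b′ →
    Close ε (λ n → a n ℚ.* b n) (λ n → a′ n ℚ.* b′ n)
  *-close {A} {B} {δ} {ε} a a′ b b′ A>0 δ>0 e (M₁ , f₁) (M₂ , f₂) (N₁ , g₁) (N₂ , g₂) =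
    M ℕ.⊔ N , λ m n m≥ n≥ →
      *-bound {A} {B} {δ} {ε} {a m} {a′ n} {b m} {b′ n} A>0 δ>0 e
        (f₁ m (⊔ˡ M₁ M₂ (⊔ˡ M N m≥))) (f₂ n (⊔ʳ M₁ M₂ (⊔ˡ M N n≥)))
        (g₁ m n (⊔ˡ N₁ N₂ (⊔ʳ M N m≥)) (⊔ˡ N₁ N₂ (⊔ʳ M N n≥)))
        (g₂ m n (⊔ʳ N₁ N₂ (⊔ʳ M N m≥)) (⊔ʳ N₁ N₂ (⊔ʳ M N n≥)))
    where
    M N : ℕ
    M = M₁ ℕ.⊔ M₂
    N = N₁ ℕ.⊔ N₂

  *-∼ : ∀ {a a′ b b′} → a ∼ a′ → b ∼ b′ → (λ n → a n ℚ.* b n) ∼ (λ n → a′ n ℚ.* b′ n)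
  *-∼ {a} {a′} {b} {b′} p q ε =
    let A , A>0 , bound-a = eventuallyBounded {a} {a′} p
        B , B>0 , bound-b′ = eventuallyBounded {b′} {b} (∼-sym {b} {b′} q)
        δ , δ>0 , e = share A B ε A>0 B>0 (ℚ.positive (ℚ.positive⁻¹ ε))
    in *-close {A} {B} {δ} {ε} a a′ b b′ A>0 δ>0 e bound-a bound-b′ (p δ {{δ>0}}) (q δ {{δ>0}})

fromℚ : ℚ → ℝ
seq    (fromℚ c) _ = c
cauchy (fromℚ c)   = ∼-const c

infixl 6 _+ℝ_
infixl 7 _*ℝ_
infix  8 -ℝ_

_+ℝ_ : ℝ → ℝ → ℝ
seq    (x +ℝ y) n = seq x n ℚ.+ seq y n
cauchy (x +ℝ y)   = +-∼ {seq x} {seq x} {seq y} {seq y} (cauchy x) (cauchy y)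

_*ℝ_ : ℝ → ℝ → ℝ
seq    (x *ℝ y) n = seq x n ℚ.* seq y n
cauchy (x *ℝ y)   = *-∼ {seq x} {seq x} {seq y} {seq y} (cauchy x) (cauchy y)

-ℝ_ : ℝ → ℝ
seq    (-ℝ x) n = ℚ.- seq x n
cauchy (-ℝ x)   = neg-∼ {seq x} {seq x} (cauchy x)

≃-isEquivalence : IsEquivalence _≃_
≃-isEquivalence = record
  { refl  = λ {x} → mk≃ (cauchy x)
  ; sym   = λ {x} {y} p → mk≃ (∼-sym {seq x} {seq y} (close p))
  ; trans = λ {x} {y} {z} p q → mk≃ (∼-trans {seq x} {seq y} {seq z} (close p) (close q))
  }

private
  pointwise : ∀ {x y} → (∀ n → seq x n ≡ seq y n) → x ≃ y
  pointwise {x} {y} e = mk≃ (∼-pointwise {seq x} {seq y} (cauchy x) e)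

ℝ-commutativeRing : CommutativeRing 0ℓ 0ℓ
ℝ-commutativeRing = record
  { Carrier = ℝ
  ; _≈_ = _≃_
  ; _+_ = _+ℝ_
  ; _*_ = _*ℝ_
  ; -_ = -ℝ_
  ; 0# = fromℚ 0ℚ
  ; 1# = fromℚ 1ℚ
  ; isCommutativeRing = record
    { isRing = record
      { +-isAbelianGroup = record
        { isGroup = record
          { isMonoid = record
            { isSemigroup = record
              { isMagma = record
                { isEquivalence = ≃-isEquivalence
                ; ∙-cong = λ {x} {x′} {y} {y′} p q → mk≃ (+-∼ {seq x} {seq x′} {seq y} {seq y′} (close p) (close q))
                }
              ; assoc = λ x y z → pointwise λ n → ℚ.+-assoc (seq x n) (seq y n) (seq z n)
              }
            ; identity = (λ x → pointwise λ n → ℚ.+-identityˡ (seq x n))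
                       , (λ x → pointwise λ n → ℚ.+-identityʳ (seq x n))
            }
          ; inverse = (λ x → pointwise λ n → ℚ.+-inverseˡ (seq x n))
                    , (λ x → pointwise λ n → ℚ.+-inverseʳ (seq x n))
          ; ⁻¹-cong = λ {x} {y} p → mk≃ (neg-∼ {seq x} {seq y} (close p))
          }
        ; comm = λ x y → pointwise λ n → ℚ.+-comm (seq x n) (seq y n)
        }
      ; *-cong = λ {x} {x′} {y} {y′} p q → mk≃ (*-∼ {seq x} {seq x′} {seq y} {seq y′} (close p) (close q))
      ; *-assoc = λ x y z → pointwise λ n → ℚ.*-assoc (seq x n) (seq y n) (seq z n)
      ; *-identity = (λ x → pointwise λ n → ℚ.*-identityˡ (seq x n))
                   , (λ x → pointwise λ n → ℚ.*-identityʳ (seq x n))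
      ; distrib = (λ x y z → pointwise λ n → ℚ.*-distribˡ-+ (seq x n) (seq y n) (seq z n))
                , (λ x y z → pointwise λ n → ℚ.*-distribʳ-+ (seq x n) (seq y n) (seq z n))
      }
    ; *-comm = λ x y → pointwise λ n → ℚ.*-comm (seq x n) (seq y n)
    }
  }

record ℂ : Set where
  no-eta-equality
  field
    re : ℝ
    im : ℝ

open ℂ public

infix 4 _≈ᶜ_

record _≈ᶜ_ (z w : ℂ) : Set where
  no-eta-equality
  pattern
  constructor _,_
  field
    re-≃ : re z ≃ re w
    im-≃ : im z ≃ im w

open _≈ᶜ_ public

infixl 6 _+ᶜ_
infixl 7 _*ᶜ_
infix  8 -ᶜ_

_+ᶜ_ : ℂ → ℂ → ℂ
re (z +ᶜ w) = re z +ℝ re w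
im (z +ᶜ w) = im z +ℝ im w

_*ᶜ_ : ℂ → ℂ → ℂ
re (z *ᶜ w) = re z *ℝ re w +ℝ (-ℝ (im z *ℝ im w))
im (z *ᶜ w) = re z *ℝ im w +ℝ im z *ℝ re w

-ᶜ_ : ℂ → ℂ
re (-ᶜ z) = -ℝ re z
im (-ᶜ z) = -ℝ im z

0ᶜ : ℂ
re 0ᶜ = fromℚ 0ℚ
im 0ᶜ = fromℚ 0ℚ

1ᶜ : ℂ
re 1ᶜ = fromℚ 1ℚ
im 1ᶜ = fromℚ 0ℚ

private

  module R = CommutativeRing ℝ-commutativeRing

  ≈ᶜ-trans : ∀ {x y z} → x ≈ᶜ y → y ≈ᶜ z → x ≈ᶜ z
  ≈ᶜ-trans (p , p′) (q , q′) = R.trans p q , R.trans p′ q′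

  +ᶜ-cong : ∀ {x y u v} → x ≈ᶜ y → u ≈ᶜ v → x +ᶜ u ≈ᶜ y +ᶜ v
  +ᶜ-cong (p , p′) (q , q′) = R.+-cong p q , R.+-cong p′ q′

  *ᶜ-comm : ∀ x y → x *ᶜ y ≈ᶜ y *ᶜ x
  *ᶜ-comm x y =
    pointwise (λ n → comm-re (seq (re x) n) (seq (im x) n) (seq (re y) n) (seq (im y) n)) ,
    pointwise (λ n → comm-im (seq (re x) n) (seq (im x) n) (seq (re y) n) (seq (im y) n))

  *ᶜ-assoc : ∀ x y z → (x *ᶜ y) *ᶜ z ≈ᶜ x *ᶜ (y *ᶜ z)
  *ᶜ-assoc x y z =
    pointwise (λ n → assoc-re (seq (re x) n) (seq (im x) n) (seq (re y) n) (seq (im y) n) (seq (re z) n) (seq (im z) n)) ,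
    pointwise (λ n → assoc-im (seq (re x) n) (seq (im x) n) (seq (re y) n) (seq (im y) n) (seq (re z) n) (seq (im z) n))

  *ᶜ-identityˡ : ∀ x → 1ᶜ *ᶜ x ≈ᶜ x
  *ᶜ-identityˡ x =
    pointwise (λ n → identity-re (seq (re x) n) (seq (im x) n)) ,
    pointwise (λ n → identity-im (seq (re x) n) (seq (im x) n))

  *ᶜ-distribˡ : ∀ x y z → x *ᶜ (y +ᶜ z) ≈ᶜ x *ᶜ y +ᶜ x *ᶜ z
  *ᶜ-distribˡ x y z =
    pointwise (λ n → distrib-re (seq (re x) n) (seq (im x) n) (seq (re y) n) (seq (im y) n) (seq (re z) n) (seq (im z) n)) ,
    pointwise (λ n → distrib-im (seq (re x) n) (seq (im x) n) (seq (re y) n) (seq (im y) n) (seq (re z) n) (seq (im z) n))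

ℂ-commutativeRing : CommutativeRing 0ℓ 0ℓ
ℂ-commutativeRing = record
  { Carrier = ℂ
  ; _≈_ = _≈ᶜ_
  ; _+_ = _+ᶜ_
  ; _*_ = _*ᶜ_
  ; -_ = -ᶜ_
  ; 0# = 0ᶜ
  ; 1# = 1ᶜ
  ; isCommutativeRing = record
    { isRing = record
      { +-isAbelianGroup = record
        { isGroup = record
          { isMonoid = record
            { isSemigroup = record
              { isMagma = record
                { isEquivalence = record
                  { refl = R.refl , R.refl
                  ; sym = λ (p , q) → R.sym p , R.sym q
                  ; trans = ≈ᶜ-trans
                  }
                ; ∙-cong = +ᶜ-cong
                }
              ; assoc = λ x y z → R.+-assoc (re x) (re y) (re z) , R.+-assoc (im x) (im y) (im z)
              }
            ; identity = (λ x → R.+-identityˡ (re x) , R.+-identityˡ (im x))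
                       , (λ x → R.+-identityʳ (re x) , R.+-identityʳ (im x))
            }
          ; inverse = (λ x → R.-‿inverseˡ (re x) , R.-‿inverseˡ (im x))
                    , (λ x → R.-‿inverseʳ (re x) , R.-‿inverseʳ (im x))
          ; ⁻¹-cong = λ (p , q) → R.-‿cong p , R.-‿cong q
          }
        ; comm = λ x y → R.+-comm (re x) (re y) , R.+-comm (im x) (im y)
        }
      ; *-cong = λ (p , p′) (q , q′) →
          R.+-cong (R.*-cong p q) (R.-‿cong (R.*-cong p′ q′)) , R.+-cong (R.*-cong p q′) (R.*-cong p′ q)
      ; *-assoc = *ᶜ-assoc
      ; *-identity = *ᶜ-identityˡ
                   , (λ x → ≈ᶜ-trans (*ᶜ-comm x 1ᶜ) (*ᶜ-identityˡ x))
      ; distrib = *ᶜ-distribˡ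
                , (λ x y z → ≈ᶜ-trans (*ᶜ-comm (y +ᶜ z) x)
                               (≈ᶜ-trans (*ᶜ-distribˡ x y z) (+ᶜ-cong (*ᶜ-comm x y) (*ᶜ-comm x z))))
      }
    ; *-comm = *ᶜ-comm
    }
  }

-- A multiset is its multiplicity function.  It is only used on finite types, so
-- every multiset is finite.
Multiset : Set → Set
Multiset A = A → ℕ

record Multigraph : Set₁ where
  field
    Vertex                 : Set
    vertices               : List Vertex
    vertices-complete      : ∀ x → x ∈ vertices
    vertices-unique        : Unique vertices
    multiplicity           : Vertex → Vertex → ℕ
    multiplicity-symmetric : ∀ x y → multiplicity x y ≡ multiplicity y x

sumℕ : ∀ {A : Set} → List A → (A → ℕ) → ℕ
sumℕ xs f = foldr ℕ._+_ 0 (List.map f xs)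

-- The notions below make sense over any commutative ring K of scalars; they are
-- used with K = ℂ.
module Spectral (K : CommutativeRing 0ℓ 0ℓ) where

  open CommutativeRing K
  open RawMonoidDefinitions +-rawMonoid using () renaming (_×_ to _×ᴷ_)

  sumᴷ : ∀ {A : Set} → List A → (A → Carrier) → Carrier
  sumᴷ xs f = foldr _+_ 0# (List.map f xs)

  fromℕ : ℕ → Carrier
  fromℕ n = n ×ᴷ 1#

  fromℤ : ℤ → Carrier
  fromℤ (+ n)    = fromℕ n
  fromℤ -[1+ n ] = - fromℕ (suc n)

  module _ (G : Multigraph) where

    open Multigraph G

    adjacency : (Vertex → Carrier) → Vertex → Carrier
    adjacency f x = sumᴷ vertices (λ y → fromℕ (multiplicity x y) * f y)

    Eigenspace : Carrier → (Vertex → Carrier) → Set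
    Eigenspace θ f = ∀ x → adjacency f x ≈ θ * f x

    -- θ is to be the list of all distinct eigenvalues of G in decreasing order.
    -- Eigenspaces of distinct eigenvalues are independent, so the decomposition φ
    -- of the multiplicity function C is unique.
    record IsAlgebraicDesign {d : ℕ} (θ : Fin (suc d) → Carrier)
                             (t : ℕ) (C : Multiset Vertex) : Set where
      field
        φ             : Fin (suc d) → Vertex → Carrier
        φ-eigen       : ∀ i → Eigenspace (θ i) (φ i)
        decomposition : ∀ x → fromℕ (C x) ≈ sumᴷ (allFin (suc d)) (λ i → φ i x)
        φ-vanishes    : ∀ i → 1 ℕ.≤ toℕ i → toℕ i ℕ.≤ t → ∀ x → φ i x ≈ 0#

-- The vertex set [q₁] × ⋯ × [qₙ].
Word : ∀ {n} → Vec ℕ n → Set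
Word q = All Fin q

infixl 9 _‼_

_‼_ : ∀ {n} {q : Vec ℕ n} → Word q → (i : Fin n) → Fin (lookup q i)
x ‼ i = lookup⁺ x i

words : ∀ {n} (q : Vec ℕ n) → List (Word q)
words Vec.[]      = [] ∷ []
words (m Vec.∷ q) = cartesianProductWith _∷_ (allFin m) (words q)

words-complete : ∀ {n} (q : Vec ℕ n) (x : Word q) → x ∈ words q
words-complete Vec.[]      []      = here refl
words-complete (m Vec.∷ q) (a ∷ x) = ∈-cartesianProductWith⁺ _∷_ (∈-allFin a) (words-complete q x)

words-unique : ∀ {n} (q : Vec ℕ n) → Unique (words q)
words-unique Vec.[]      = ListAll.[] AllPairs.∷ AllPairs.[]
words-unique (m Vec.∷ q) =
  cartesianProductWith⁺ _∷_ (λ { refl → refl , refl }) (allFin⁺ m) (words-unique q)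

lcms : ∀ {n} → Vec ℕ n → ℕ
lcms = Vec.foldr′ lcm 1

lookup∣lcms : ∀ {n} (q : Vec ℕ n) i → lookup q i ∣ lcms q
lookup∣lcms (m Vec.∷ q) Fin.zero    = m∣lcm[m,n] m (lcms q)
lookup∣lcms (m Vec.∷ q) (Fin.suc i) = ∣-trans (lookup∣lcms q i) (n∣lcm[m,n] m (lcms q))

module _ {n : ℕ} (q : Vec ℕ n) where

  -- Q / qᵢ for Q = lcm(q₁, …, qₙ)
  edgeWeight : Fin n → ℕ
  edgeWeight i = quotient (lookup∣lcms q i)

  DifferOnlyAt : Word q → Word q → Fin n → Set
  DifferOnlyAt x y i = x ‼ i ≢ y ‼ i × (∀ j → j ≢ i → x ‼ j ≡ y ‼ j)

  differOnlyAt? : ∀ x y i → Dec (DifferOnlyAt x y i)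
  differOnlyAt? x y i =
    ¬? (x ‼ i Fin.≟ y ‼ i) ×-dec all? (λ j → ¬? (j Fin.≟ i) →-dec (x ‼ j Fin.≟ y ‼ j))

  edgeMultiplicity : Word q → Word q → ℕ
  edgeMultiplicity x y with any? (differOnlyAt? x y)
  ... | yes (i , _) = edgeWeight i
  ... | no _        = 0

  private
    swap : ∀ x y {i} → DifferOnlyAt x y i → DifferOnlyAt y x i
    swap _ _ (d , e) = (λ p → d (sym p)) , (λ k k≢i → sym (e k k≢i))

  edgeMultiplicity-symmetric : ∀ x y → edgeMultiplicity x y ≡ edgeMultiplicity y x
  edgeMultiplicity-symmetric x y with any? (differOnlyAt? x y) | any? (differOnlyAt? y x)
  ... | no _            | no _            = refl
  ... | no ¬p           | yes (j , h)     = ⊥-elim (¬p (j , swap y x h))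
  ... | yes (i , h)     | no ¬p           = ⊥-elim (¬p (i , swap x y h))
  ... | yes (i , d , _) | yes (j , _ , e) with i Fin.≟ j
  ...   | yes i≡j = cong edgeWeight i≡j
  ...   | no i≢j  = ⊥-elim (d (sym (e i i≢j)))

  H : Multigraph
  H = record
    { Vertex                 = Word q
    ; vertices               = words q
    ; vertices-complete      = words-complete q
    ; vertices-unique        = words-unique q
    ; multiplicity           = edgeMultiplicity
    ; multiplicity-symmetric = edgeMultiplicity-symmetric
    }

  -- k = Σᵢ (Q / qᵢ)(qᵢ − 1)
  degree : ℕ
  degree = sumℕ (allFin n) (λ i → edgeWeight i ℕ.* (lookup q i ℕ.∸ 1))

  -- The distinct eigenvalues of H, in decreasing order: θ_w = k − w Q.
  eigenvalue : Fin (suc n) → ℤ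
  eigenvalue w = + degree ℤ.- + (toℕ w ℕ.* lcms q)

  card : Multiset (Word q) → ℕ
  card C = sumℕ (words q) C

  -- The number of members of C whose coordinate i j is a j for every j.
  count : ∀ {t} → Multiset (Word q) → (i : Fin t → Fin n) → ((j : Fin t) → Fin (lookup q (i j))) → ℕ
  count C i a = sumℕ (filter (λ x → all? (λ j → x ‼ i j Fin.≟ a j)) (words q)) C

  -- The defining equation count = |C| / (q_{i₁}⋯q_{iₜ}), with the denominator cleared.
  IsOrthogonalArray : ℕ → Multiset (Word q) → Set
  IsOrthogonalArray t C =
    (i : Fin t → Fin n) → Injective _≡_ _≡_ i →
    (a : (j : Fin t) → Fin (lookup q (i j))) →
    count C i a ℕ.* foldr ℕ._*_ 1 (List.map (λ j → lookup q (i j)) (allFin t)) ≡ card C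

NonEmpty : ∀ {A : Set} → Multiset A → Set
NonEmpty C = ∃[ x ] 1 ℕ.≤ C x

{-# OPTIONS --safe #-}

-- Let E i be the operator averaging a function over the i-th coordinate.  The E i
-- are commuting idempotents, the adjacency operator of H is k − Q · Σᵢ (1 − E i),
-- and hence f is an eigenfunction for θ_w iff Σᵢ (1 − E i) f = w f.  On the other
-- hand C is an orthogonal array of strength t iff averaging its multiplicity
-- function over the complement of any t coordinates gives a constant.
-- Expanding f = Πᵢ (E i + (1 − E i)) f yields the components of f, those of weight
-- 1, …, t being killed by this constancy.  Conversely, the average of an
-- eigenfunction over the complement of T is an eigenfunction of Σ_{i ∈ T} (1 − E i),
-- whose eigenvalues are at most |T|, so averaging kills the components of weight > t
-- and only the constant component of weight 0 survives.

module Submission where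

open import Level using (0ℓ)
open import Algebra.Bundles using (CommutativeRing)
import Algebra.Properties.CommutativeSemigroup as CommutativeSemigroupProperties
import Algebra.Properties.Group as GroupProperties
import Algebra.Properties.Ring as RingProperties
import Algebra.Properties.Semiring.Mult as SemiringMult
import Algebra.Solver.Ring.NaturalCoefficients.Default as SemiringSolver
open import Data.Empty using (⊥-elim)
open import Data.Fin as Fin using (Fin; toℕ)
import Data.Fin.Properties as Fin
open import Data.Integer as ℤ using (+_)
import Data.Integer.Properties as ℤ
open import Data.List as List using (List; []; _∷_; _++_; allFin; tabulate; filter; length)
open import Data.List.Membership.DecPropositional using (_∈?_)
open import Data.List.Membership.Propositional using (_∈_; _∉_)
open import Data.List.Membership.Propositional.Properties
  using (∈-allFin; ∈-lookup; ∈-++⁺ˡ; ∈-++⁺ʳ; ∈-++⁻; ∈-filter⁺; ∈-filter⁻; ∈-tabulate⁺; ∈-tabulate⁻)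
open import Data.List.Membership.Propositional.Properties.WithK using (unique∧set⇒bag)
import Data.List.Properties as List
open import Data.List.Relation.Binary.BagAndSetEquality using (∼bag⇒↭)
open import Data.List.Relation.Binary.Permutation.Propositional as ↭ using (_↭_; prep; swap; ↭-sym; ↭⇒↭ₛ)
open import Data.List.Relation.Binary.Permutation.Propositional.Properties using (∈-resp-↭; ↭-length; shift)
open import Data.List.Relation.Binary.Permutation.Setoid.Properties using (Unique-resp-↭)
import Data.List.Relation.Unary.All as ListAll
import Data.List.Relation.Unary.All.Properties as ListAll
open import Data.List.Relation.Unary.AllPairs using ([]; _∷_)
open import Data.List.Relation.Unary.Any using (here; there)
open import Data.List.Relation.Unary.Unique.Propositional using (Unique)
open import Data.List.Relation.Unary.Unique.Propositional.Properties
  using (Unique[x∷xs]⇒x∉xs; allFin⁺; filter⁺; tabulate⁺; ++⁺)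
open import Data.Nat as ℕ using (ℕ; zero; suc; _≤_; _<_; z≤n; s≤s)
open import Data.Nat.Divisibility using (m∣n⇒n≡quotient*m)
open import Data.Nat.GCD using (gcd)
open import Data.Nat.LCM using (lcm; gcd*lcm)
import Data.Nat.Properties as ℕ
open import Data.Product using (Σ-syntax; ∃-syntax; _×_; _,_; proj₁; proj₂)
open import Data.Rational as ℚ using (ℚ; 0ℚ; 1ℚ; ½)
import Data.Rational.Properties as ℚ
open import Data.Sum using (_⊎_; inj₁; inj₂)
open import Data.Vec as Vec using (Vec; lookup)
open import Data.Vec.Relation.Unary.All using (All; []; _∷_)
open import Data.Vec.Relation.Unary.All.Properties using (lookup⁺; lookup⁻)
open import Function using (_∘_)
open import Function.Bundles using (_⇔_; mk⇔)
open import Function.Definitions using (Injective)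
open import Relation.Binary using (tri<; tri≈; tri>)
open import Relation.Binary.PropositionalEquality as ≡ using (_≡_; _≢_)
open import Relation.Nullary using (Dec; yes; no; ¬_; ¬?)
open import Relation.Nullary.Decidable using (_→-dec_; toWitnessFalse)
open import Defs

-- The multiplicities Q / q_i make the directions comparable. A word and its neighbours in direction
-- i form a line of q_i words, over which f sums to q_i times `E i f`; the weight Q / q_i turns this
-- into Q times `E i f`, with the same Q for every i. This is why the eigenvalues depend only on the
-- number of coordinates involved and not on which ones.
--
-- In place of a basis of characters, eigenvalues are tracked by splitting f into `E i f` and (1 - E
-- i) f one coordinate at a time: the sum over the remaining coordinates keeps its eigenvalue on the
-- first part and loses 1 on the second. Equality of Cauchy complex numbers is not treated as
-- decidable, so two weights are separated by inverting their difference, a positive integer. The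
-- argument therefore runs over any commutative ring in which positive integers are invertible and 1
-- ≠ 0.
--
-- Constancy of an average yields zero only after some factor 1 - E i is applied to it. This is why
-- weight 0 escapes and why the vanishing of components is proved by two nested inductions.

-- Finite sums and integer multiples over a commutative ring

module FiniteSums (K : CommutativeRing 0ℓ 0ℓ) where

  open CommutativeRing K hiding (zero)
  open Spectral K using (sumᴷ; fromℕ; fromℤ)
  open SemiringMult semiring using (×-homo-+; ×1-homo-*)
  open CommutativeSemigroupProperties +-commutativeSemigroup using (interchange; x∙yz≈y∙xz)
  open import Relation.Binary.Reasoning.Setoid setoid

  fromℕ-+ : ∀ m n → fromℕ (m ℕ.+ n) ≈ fromℕ m + fromℕ n
  fromℕ-+ = ×-homo-+ 1#

  fromℕ-* : ∀ m n → fromℕ (m ℕ.* n) ≈ fromℕ m * fromℕ n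
  fromℕ-* = ×1-homo-*

  fromℕ-1 : fromℕ 1 ≈ 1#
  fromℕ-1 = +-identityʳ 1#

  fromℤ-⊖ : ∀ m n → fromℤ (m ℤ.⊖ n) + fromℕ n ≈ fromℕ m
  fromℤ-⊖ m       zero    = +-identityʳ (fromℕ m)
  fromℤ-⊖ zero    (suc n) = -‿inverseˡ (fromℕ (suc n))
  fromℤ-⊖ (suc m) (suc n) rewrite ℤ.[1+m]⊖[1+n]≡m⊖n m n = begin
    fromℤ (m ℤ.⊖ n) + (1# + fromℕ n)  ≈⟨ x∙yz≈y∙xz _ 1# (fromℕ n) ⟩
    1# + (fromℤ (m ℤ.⊖ n) + fromℕ n)  ≈⟨ +-congˡ (fromℤ-⊖ m n) ⟩
    1# + fromℕ m                      ∎

  -- The form in which eigenvalues k - wQ enter: transposed, so that the sign cases of `fromℤ`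
  -- disappear and later computations stay within a commutative semiring.
  fromℤ-− : ∀ m n → fromℤ (+ m ℤ.- + n) + fromℕ n ≈ fromℕ m
  fromℤ-− m n rewrite ℤ.m-n≡m⊖n m n = fromℤ-⊖ m n

  module _ {A : Set} where

    sum-cong : ∀ (xs : List A) {f g} → (∀ {x} → x ∈ xs → f x ≈ g x) → sumᴷ xs f ≈ sumᴷ xs g
    sum-cong []       e = refl
    sum-cong (x ∷ xs) e = +-cong (e (here ≡.refl)) (sum-cong xs (λ x∈ → e (there x∈)))

    sum-0 : ∀ (xs : List A) → sumᴷ xs (λ _ → 0#) ≈ 0#
    sum-0 []       = refl
    sum-0 (x ∷ xs) = trans (+-identityˡ _) (sum-0 xs)

    sum-vanish : ∀ (xs : List A) {f} → (∀ {x} → x ∈ xs → f x ≈ 0#) → sumᴷ xs f ≈ 0#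
    sum-vanish xs e = trans (sum-cong xs e) (sum-0 xs)

    sum-+ : ∀ (xs : List A) f g → sumᴷ xs (λ x → f x + g x) ≈ sumᴷ xs f + sumᴷ xs g
    sum-+ []       f g = sym (+-identityˡ 0#)
    sum-+ (x ∷ xs) f g = begin
      (f x + g x) + sumᴷ xs (λ x → f x + g x)    ≈⟨ +-congˡ (sum-+ xs f g) ⟩
      (f x + g x) + (sumᴷ xs f + sumᴷ xs g)      ≈⟨ interchange _ _ _ _ ⟩
      (f x + sumᴷ xs f) + (g x + sumᴷ xs g)      ∎

    sum-*ˡ : ∀ (xs : List A) c f → sumᴷ xs (λ x → c * f x) ≈ c * sumᴷ xs f
    sum-*ˡ []       c f = sym (zeroʳ c)
    sum-*ˡ (x ∷ xs) c f = trans (+-congˡ (sum-*ˡ xs c f)) (sym (distribˡ c _ _))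

    sum-*ʳ : ∀ (xs : List A) c f → sumᴷ xs (λ x → f x * c) ≈ sumᴷ xs f * c
    sum-*ʳ xs c f = begin
      sumᴷ xs (λ x → f x * c)  ≈⟨ sum-cong xs (λ _ → *-comm _ c) ⟩
      sumᴷ xs (λ x → c * f x)  ≈⟨ sum-*ˡ xs c f ⟩
      c * sumᴷ xs f            ≈⟨ *-comm c _ ⟩
      sumᴷ xs f * c            ∎

    sum-const : ∀ (xs : List A) c → sumᴷ xs (λ _ → c) ≈ fromℕ (length xs) * c
    sum-const []       c = sym (zeroˡ c)
    sum-const (x ∷ xs) c = begin
      c + sumᴷ xs (λ _ → c)              ≈⟨ +-cong (sym (*-identityˡ c)) (sum-const xs c) ⟩
      1# * c + fromℕ (length xs) * c     ≈⟨ distribʳ c 1# _ ⟨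
      (1# + fromℕ (length xs)) * c       ∎

    sum-++ : ∀ (xs ys : List A) f → sumᴷ (xs ++ ys) f ≈ sumᴷ xs f + sumᴷ ys f
    sum-++ []       ys f = sym (+-identityˡ _)
    sum-++ (x ∷ xs) ys f = trans (+-congˡ (sum-++ xs ys f)) (sym (+-assoc _ _ _))

    sum-↭ : ∀ {xs ys : List A} → xs ↭ ys → ∀ f → sumᴷ xs f ≈ sumᴷ ys f
    sum-↭ ↭.refl        f = refl
    sum-↭ (prep x p)    f = +-congˡ (sum-↭ p f)
    sum-↭ (swap x y p)  f = trans (+-congˡ (+-congˡ (sum-↭ p f))) (x∙yz≈y∙xz _ _ _)
    sum-↭ (↭.trans p q) f = trans (sum-↭ p f) (sum-↭ q f)

    fromℕ-sum : ∀ (xs : List A) f → fromℕ (sumℕ xs f) ≈ sumᴷ xs (λ x → fromℕ (f x))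
    fromℕ-sum []       f = refl
    fromℕ-sum (x ∷ xs) f = trans (fromℕ-+ (f x) _) (+-congˡ (fromℕ-sum xs f))

  sum-swap : ∀ {A B : Set} (xs : List A) (ys : List B) (f : A → B → Carrier) →
    sumᴷ xs (λ x → sumᴷ ys (λ y → f x y)) ≈ sumᴷ ys (λ y → sumᴷ xs (λ x → f x y))
  sum-swap []       ys f = sym (sum-0 ys)
  sum-swap (x ∷ xs) ys f = trans (+-congˡ (sum-swap xs ys f)) (sym (sum-+ ys _ _))

  sum-allFin-suc : ∀ m (f : Fin (suc m) → Carrier) →
    sumᴷ (allFin (suc m)) f ≈ f Fin.zero + sumᴷ (allFin m) (f ∘ Fin.suc)
  sum-allFin-suc m f = reflexive (≡.cong (λ l → f Fin.zero + List.foldr _+_ 0# l)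
    (≡.trans (List.map-tabulate Fin.suc f) (≡.sym (List.map-tabulate (λ i → i) (f ∘ Fin.suc)))))

  indicator : ∀ {P : Set} → Dec P → Carrier
  indicator (yes _) = 1#
  indicator (no _)  = 0#

  indicator-yes : ∀ {P : Set} (d : Dec P) → P → indicator d ≈ 1#
  indicator-yes (yes _) p = refl
  indicator-yes (no ¬p) p = ⊥-elim (¬p p)

  indicator-no : ∀ {P : Set} (d : Dec P) → ¬ P → indicator d ≈ 0#
  indicator-no (yes p) ¬p = ⊥-elim (¬p p)
  indicator-no (no _)  ¬p = refl

  indicator-cong : ∀ {P Q : Set} (d : Dec P) (e : Dec Q) → (P → Q) → (Q → P) → indicator d ≈ indicator e
  indicator-cong (yes p) e to from = sym (indicator-yes e (to p))
  indicator-cong (no ¬p) e to from = sym (indicator-no e (λ q → ¬p (from q)))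

  module _ {A : Set} {P : A → Set} (P? : ∀ x → Dec (P x)) where

    sum-filter : ∀ xs (f : A → Carrier) → sumᴷ (filter P? xs) f ≈ sumᴷ xs (λ x → indicator (P? x) * f x)
    sum-filter []       f = refl
    sum-filter (x ∷ xs) f with P? x
    ... | yes _ = +-cong (sym (*-identityˡ (f x))) (sum-filter xs f)
    ... | no _  = trans (sum-filter xs f) (trans (sym (+-identityˡ _)) (+-congʳ (sym (zeroˡ (f x)))))

    -- Membership makes the one nonzero term occur, and the absence of repetitions makes it occur
    -- only once.
    sum-indicator-singleton : ∀ {xs z} → Unique xs → z ∈ xs → P z → (∀ {y} → P y → y ≡ z) → ∀ (f : A → Carrier) →
      sumᴷ xs (λ y → indicator (P? y) * f y) ≈ f z
    sum-indicator-singleton {z ∷ xs} u (here ≡.refl) Pz only f = begin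
      indicator (P? z) * f z + sumᴷ xs (λ y → indicator (P? y) * f y)
        ≈⟨ +-cong (trans (*-congʳ (indicator-yes (P? z) Pz)) (*-identityˡ (f z)))
             (sum-vanish xs λ {y} y∈ → trans
               (*-congʳ (indicator-no (P? y) λ Py → Unique[x∷xs]⇒x∉xs u (≡.subst (_∈ xs) (only Py) y∈)))
               (zeroˡ (f y))) ⟩
      f z + 0#  ≈⟨ +-identityʳ (f z) ⟩
      f z       ∎
    sum-indicator-singleton {x ∷ xs} {z} u@(_ ∷ u′) (there z∈) Pz only f = begin
      indicator (P? x) * f x + sumᴷ xs (λ y → indicator (P? y) * f y)
        ≈⟨ +-cong (trans
             (*-congʳ (indicator-no (P? x) λ Px → Unique[x∷xs]⇒x∉xs u (≡.subst (_∈ xs) (≡.sym (only Px)) z∈)))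
             (zeroˡ (f x)))
             (sum-indicator-singleton u′ z∈ Pz only f) ⟩
      0# + f z  ≈⟨ +-identityˡ (f z) ⟩
      f z       ∎

-- Scalars in which positive integers are invertible

-- What the proof asks of ℂ. Inverses of positive integers define the means and separate
-- eigenvalues; `1≉0` lets identities between counts be read back in ℕ.
record IsRationalAlgebra (K : CommutativeRing 0ℓ 0ℓ) : Set where
  open CommutativeRing K hiding (zero)
  open Spectral K using (fromℕ)
  field
    inv   : ℕ → Carrier
    *-inv : ∀ n → 1 ≤ n → fromℕ n * inv n ≈ 1#
    1≉0   : ¬ 1# ≈ 0#

module Division (K : CommutativeRing 0ℓ 0ℓ) (A : IsRationalAlgebra K) where

  open CommutativeRing K hiding (zero)
  open Spectral K using (sumᴷ; fromℕ)
  open FiniteSums K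
  open IsRationalAlgebra A
  open GroupProperties +-group using () renaming (∙-cancelˡ to +-cancelˡ)
  open import Relation.Binary.Reasoning.Setoid setoid

  inv-* : ∀ n → 1 ≤ n → ∀ a → inv n * (fromℕ n * a) ≈ a
  inv-* n 1≤n a = begin
    inv n * (fromℕ n * a)  ≈⟨ *-assoc _ _ a ⟨
    inv n * fromℕ n * a    ≈⟨ *-congʳ (*-comm _ _) ⟩
    fromℕ n * inv n * a    ≈⟨ *-congʳ (*-inv n 1≤n) ⟩
    1# * a                 ≈⟨ *-identityˡ a ⟩
    a                      ∎

  fromℕ-*-cancelˡ : ∀ n → 1 ≤ n → ∀ {a b} → fromℕ n * a ≈ fromℕ n * b → a ≈ b
  fromℕ-*-cancelˡ n 1≤n {a} {b} e =
    trans (sym (inv-* n 1≤n a)) (trans (*-congˡ e) (inv-* n 1≤n b))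

  -- The hypothesis says (n - m) a = 0, and n - m is a positive integer, hence invertible. No test
  -- whether `a` is zero is involved.
  multiples-separate : ∀ {m n a} → m < n → fromℕ m * a ≈ fromℕ n * a → a ≈ 0#
  multiples-separate {m} {n} {a} m<n e = fromℕ-*-cancelˡ (n ℕ.∸ m) (ℕ.m<n⇒0<n∸m m<n) (begin
    fromℕ (n ℕ.∸ m) * a  ≈⟨ +-cancelˡ (fromℕ m * a) _ _ difference ⟩
    0#                   ≈⟨ zeroʳ _ ⟨
    fromℕ (n ℕ.∸ m) * 0# ∎)
    where
    difference : fromℕ m * a + fromℕ (n ℕ.∸ m) * a ≈ fromℕ m * a + 0#
    difference = begin
      fromℕ m * a + fromℕ (n ℕ.∸ m) * a  ≈⟨ distribʳ a _ _ ⟨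
      (fromℕ m + fromℕ (n ℕ.∸ m)) * a    ≈⟨ *-congʳ (fromℕ-+ m (n ℕ.∸ m)) ⟨
      fromℕ (m ℕ.+ (n ℕ.∸ m)) * a        ≡⟨ ≡.cong (λ k → fromℕ k * a) (ℕ.m+[n∸m]≡n (ℕ.<⇒≤ m<n)) ⟩
      fromℕ n * a                        ≈⟨ e ⟨
      fromℕ m * a                        ≈⟨ +-identityʳ _ ⟨
      fromℕ m * a + 0#                   ∎

  fromℕ-injective : ∀ {m n} → fromℕ m ≈ fromℕ n → m ≡ n
  fromℕ-injective {m} {n} e with ℕ.<-cmp m n
  ... | tri< m<n _ _ = ⊥-elim (1≉0 (multiples-separate m<n (*-congʳ e)))
  ... | tri≈ _ m≡n _ = m≡n
  ... | tri> _ _ n<m = ⊥-elim (1≉0 (multiples-separate n<m (*-congʳ (sym e))))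

-- Commuting projections

module Projections (K : CommutativeRing 0ℓ 0ℓ) (X : Set) where

  open CommutativeRing K hiding (zero)
  open Spectral K using (sumᴷ; fromℕ)
  open FiniteSums K

  infix 4 _≋_

  _≋_ : (X → Carrier) → (X → Carrier) → Set
  f ≋ g = ∀ x → f x ≈ g x

  Constant : (X → Carrier) → Set
  Constant f = ∀ x y → f x ≈ f y

  Constant-resp : ∀ {f g} → f ≋ g → Constant f → Constant g
  Constant-resp e c x y = trans (sym (e x)) (trans (c x y) (e y))

  record CommutingProjections (I : Set) : Set where
    field
      E       : I → (X → Carrier) → X → Carrier
      E-cong  : ∀ i {f g} → f ≋ g → E i f ≋ E i g
      E-+     : ∀ i f g → E i (λ x → f x + g x) ≋ λ x → E i f x + E i g x
      E-*     : ∀ i c f → E i (λ x → c * f x) ≋ λ x → c * E i f x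
      E-idem  : ∀ i f → E i (E i f) ≋ E i f
      E-comm  : ∀ i j f → E i (E j f) ≋ E j (E i f)
      E-const : ∀ i {f} → Constant f → E i f ≋ f

  module ProjectionAlgebra {I : Set} (projections : CommutingProjections I) where

    open CommutingProjections projections
    open CommutativeSemigroupProperties +-commutativeSemigroup using (interchange; x∙yz≈y∙xz)
    open SemiringSolver commutativeSemiring using (solve; _:=_; _:*_)
    open import Relation.Binary.Reasoning.Setoid setoid

    cancel-−1 : ∀ a → a + (- 1#) * a ≈ 0#
    cancel-−1 a = trans (+-congˡ (RingProperties.-1*x≈-x ring a)) (-‿inverseʳ a)

    -- Linear operators commuting with every `E i`. They are closed under composition, sums and
    -- scalar multiples, so commutation of `E⊥`, `number`, `average` and `component` follows from
    -- how they are built.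
    record InCommutant (T : (X → Carrier) → X → Carrier) : Set where
      field
        T-cong : ∀ {f g} → f ≋ g → T f ≋ T g
        T-+    : ∀ f g → T (λ x → f x + g x) ≋ λ x → T f x + T g x
        T-*    : ∀ c f → T (λ x → c * f x) ≋ λ x → c * T f x
        T-E    : ∀ i f → T (E i f) ≋ E i (T f)

      T-0 : ∀ {f} → f ≋ (λ _ → 0#) → T f ≋ λ _ → 0#
      T-0 {f} f≋0 x = begin
        T f x                ≈⟨ T-cong (λ y → trans (f≋0 y) (sym (zeroˡ (f y)))) x ⟩
        T (λ y → 0# * f y) x ≈⟨ T-* 0# f x ⟩
        0# * T f x           ≈⟨ zeroˡ _ ⟩
        0#                   ∎

      T-sum : ∀ {A : Set} (xs : List A) (h : A → X → Carrier) → T (λ x → sumᴷ xs (λ a → h a x)) ≋ λ x → sumᴷ xs (λ a → T (h a) x)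
      T-sum []       h   = T-0 (λ _ → refl)
      T-sum (a ∷ xs) h x = trans (T-+ (h a) _ x) (+-congˡ (T-sum xs h x))

    open InCommutant

    id-commutant : InCommutant (λ f → f)
    id-commutant = record
      { T-cong = λ e → e ; T-+ = λ _ _ _ → refl ; T-* = λ _ _ _ → refl ; T-E = λ _ _ _ → refl }

    0-commutant : InCommutant (λ _ _ → 0#)
    0-commutant = record
      { T-cong = λ _ _ → refl ; T-+ = λ _ _ _ → sym (+-identityˡ 0#) ; T-* = λ c _ _ → sym (zeroʳ c)
      ; T-E = λ i f x → sym (E-const i (λ _ _ → refl) x) }

    E-commutant : ∀ i → InCommutant (E i)
    E-commutant i = record { T-cong = E-cong i ; T-+ = E-+ i ; T-* = E-* i ; T-E = λ j f → E-comm i j f }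

    ∘-commutant : ∀ {T U} → InCommutant T → InCommutant U → InCommutant (λ f → T (U f))
    ∘-commutant a b = record
      { T-cong = λ e → T-cong a (T-cong b e)
      ; T-+ = λ f g x → trans (T-cong a (T-+ b f g) x) (T-+ a _ _ x)
      ; T-* = λ c f x → trans (T-cong a (T-* b c f) x) (T-* a c _ x)
      ; T-E = λ i f x → trans (T-cong a (T-E b i f) x) (T-E a i _ x)
      }

    *-commutant : ∀ c {T} → InCommutant T → InCommutant (λ f x → c * T f x)
    *-commutant c {T} a = record
      { T-cong = λ e x → *-congˡ (T-cong a e x)
      ; T-+ = λ f g x → trans (*-congˡ (T-+ a f g x)) (distribˡ c _ _)
      ; T-* = λ d f x → trans (*-congˡ (T-* a d f x))
                (solve 3 (λ c d t → c :* (d :* t) := d :* (c :* t)) refl c d (T f x))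
      ; T-E = λ i f x → trans (*-congˡ (T-E a i f x)) (sym (E-* i c (T f) x))
      }

    +-commutant : ∀ {T U} → InCommutant T → InCommutant U → InCommutant (λ f x → T f x + U f x)
    +-commutant a b = record
      { T-cong = λ e x → +-cong (T-cong a e x) (T-cong b e x)
      ; T-+ = λ f g x → trans (+-cong (T-+ a f g x) (T-+ b f g x)) (interchange _ _ _ _)
      ; T-* = λ c f x → trans (+-cong (T-* a c f x) (T-* b c f x)) (sym (distribˡ c _ _))
      ; T-E = λ i f x → trans (+-cong (T-E a i f x) (T-E b i f x)) (sym (E-+ i _ _ x))
      }

    -- 1 - E i, written with the scalar -1 so that the closure of the commutant under sums and
    -- multiples applies.
    E⊥ : I → (X → Carrier) → X → Carrier
    E⊥ i f x = f x + (- 1#) * E i f x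

    E⊥-commutant : ∀ i → InCommutant (E⊥ i)
    E⊥-commutant i = +-commutant id-commutant (*-commutant (- 1#) (E-commutant i))

    T-E⊥ : ∀ {T} → InCommutant T → ∀ i f → T (E⊥ i f) ≋ E⊥ i (T f)
    T-E⊥ a i f x = trans (T-+ a _ _ x) (+-congˡ (trans (T-* a (- 1#) _ x) (*-congˡ (T-E a i f x))))

    E⊥+E : ∀ i f x → E⊥ i f x + E i f x ≈ f x
    E⊥+E i f x = begin
      (f x + (- 1#) * E i f x) + E i f x  ≈⟨ +-assoc _ _ _ ⟩
      f x + ((- 1#) * E i f x + E i f x)  ≈⟨ +-congˡ (+-comm _ _) ⟩
      f x + (E i f x + (- 1#) * E i f x)  ≈⟨ +-congˡ (cancel-−1 _) ⟩
      f x + 0#                            ≈⟨ +-identityʳ _ ⟩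
      f x                                 ∎

    E⊥-fixed : ∀ i {f} → E i f ≋ f → E⊥ i f ≋ λ _ → 0#
    E⊥-fixed i {f} e x = trans (+-congˡ (*-congˡ (e x))) (cancel-−1 (f x))

    E-E⊥ : ∀ i f → E i (E⊥ i f) ≋ λ _ → 0#
    E-E⊥ i f x = trans (T-E⊥ (E-commutant i) i f x) (E⊥-fixed i (E-idem i f) x)

    E⊥-E⊥ : ∀ i f → E⊥ i (E⊥ i f) ≋ E⊥ i f
    E⊥-E⊥ i f x = begin
      E⊥ i f x + (- 1#) * E i (E⊥ i f) x  ≈⟨ +-congˡ (trans (*-congˡ (E-E⊥ i f x)) (zeroʳ _)) ⟩
      E⊥ i f x + 0#                       ≈⟨ +-identityʳ _ ⟩
      E⊥ i f x                            ∎

    -- A number operator: a joint eigenfunction of the `E i` is multiplied by the number of entries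
    -- of `L` whose projection kills it.
    number : List I → (X → Carrier) → X → Carrier
    number L f x = sumᴷ L (λ i → E⊥ i f x)

    number-commutant : ∀ L → InCommutant (number L)
    number-commutant []      = 0-commutant
    number-commutant (i ∷ L) = +-commutant (E⊥-commutant i) (number-commutant L)

    number-T : ∀ {T} → InCommutant T → ∀ L f → number L (T f) ≋ T (number L f)
    number-T a L f x = sym (trans (T-sum a L (λ i → E⊥ i f) x) (sum-cong L (λ {i} _ → T-E⊥ a i f x)))

    average : List I → (X → Carrier) → X → Carrier
    average []      f = f
    average (i ∷ R) f = E i (average R f)

    average-commutant : ∀ R → InCommutant (average R)
    average-commutant []      = id-commutant
    average-commutant (i ∷ R) = ∘-commutant (E-commutant i) (average-commutant R)

    average-++ : ∀ T R f → average (T ++ R) f ≋ average T (average R f)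
    average-++ []      R f x = refl
    average-++ (i ∷ T) R f   = E-cong i (average-++ T R f)

    average-fixed : ∀ R {f} → (∀ {i} → i ∈ R → E i f ≋ f) → average R f ≋ f
    average-fixed []      fixed x = refl
    average-fixed (i ∷ R) fixed x = trans (E-cong i (average-fixed R (λ i∈ → fixed (there i∈))) x) (fixed (here ≡.refl) x)

    average-constant : ∀ R {f} → Constant f → average R f ≋ f
    average-constant R c = average-fixed R (λ {i} _ → E-const i c)

    E-average : ∀ {i R} → i ∈ R → ∀ f → E i (average R f) ≋ average R f
    E-average {i} {R = i ∷ R} (here ≡.refl) f = E-idem i (average R f)
    E-average {i} {R = j ∷ R} (there i∈)    f x = trans (E-comm i j _ x) (E-cong j (E-average i∈ f) x)

    number-average : ∀ R f → number R (average R f) ≋ λ _ → 0#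
    number-average R f x = sum-vanish R (λ {i} i∈ → E⊥-fixed i (E-average i∈ f) x)

    -- component L w is the sum of the terms with w factors E⊥ in the expansion of
    -- the product of E i + E⊥ i over L.
    component : List I → ℕ → (X → Carrier) → X → Carrier
    component []      zero    f x = f x
    component []      (suc w) f x = 0#
    component (i ∷ L) zero    f x = component L zero (E i f) x
    component (i ∷ L) (suc w) f x = component L (suc w) (E i f) x + component L w (E⊥ i f) x

    component-commutant : ∀ L w → InCommutant (component L w)
    component-commutant []      zero    = id-commutant
    component-commutant []      (suc w) = 0-commutant
    component-commutant (i ∷ L) zero    = ∘-commutant (component-commutant L zero) (E-commutant i)
    component-commutant (i ∷ L) (suc w) =
      +-commutant (∘-commutant (component-commutant L (suc w)) (E-commutant i))
                   (∘-commutant (component-commutant L w) (E⊥-commutant i))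

    -- The bound on `m` is an inequality because the recursion needs it twice for the same `L`: the
    -- terms with `E i` keep their weight and range over `suc m` values, those with `E⊥ i` are
    -- shifted by one and range over `m`.
    sum-component : ∀ L m → length L < m → ∀ f x → sumᴷ (allFin m) (λ w → component L (toℕ w) f x) ≈ f x
    sum-component []      (suc m) _         f x = begin
      sumᴷ (allFin (suc m)) (λ w → component [] (toℕ w) f x)  ≈⟨ sum-allFin-suc m _ ⟩
      f x + sumᴷ (allFin m) (λ _ → 0#)                        ≈⟨ +-congˡ (sum-0 (allFin m)) ⟩
      f x + 0#                                                ≈⟨ +-identityʳ _ ⟩
      f x                                                     ∎
    sum-component (i ∷ L) (suc m) (s≤s L<m) f x = begin
      sumᴷ (allFin (suc m)) (λ w → component (i ∷ L) (toℕ w) f x)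
        ≈⟨ sum-allFin-suc m _ ⟩
      a₀ + sumᴷ (allFin m) (λ w → a (suc (toℕ w)) + b (toℕ w))
        ≈⟨ +-congˡ (sum-+ (allFin m) _ _) ⟩
      a₀ + (sumᴷ (allFin m) (λ w → a (suc (toℕ w))) + sumᴷ (allFin m) (λ w → b (toℕ w)))
        ≈⟨ +-assoc _ _ _ ⟨
      (a₀ + sumᴷ (allFin m) (λ w → a (suc (toℕ w)))) + sumᴷ (allFin m) (λ w → b (toℕ w))
        ≈⟨ +-congʳ (sum-allFin-suc m (λ w → a (toℕ w))) ⟨
      sumᴷ (allFin (suc m)) (λ w → a (toℕ w)) + sumᴷ (allFin m) (λ w → b (toℕ w))
        ≈⟨ +-cong (sum-component L (suc m) (ℕ.m<n⇒m<1+n L<m) (E i f) x) (sum-component L m L<m (E⊥ i f) x) ⟩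
      E i f x + E⊥ i f x  ≈⟨ +-comm _ _ ⟩
      E⊥ i f x + E i f x  ≈⟨ E⊥+E i f x ⟩
      f x                 ∎
      where
      a b : ℕ → Carrier
      a w = component L w (E i f) x
      b w = component L w (E⊥ i f) x
      a₀ = a 0

    -- `E⊥ i` is zero on the range of `E i` and the identity on its own range, so each factor `E⊥`
    -- adds 1 to the eigenvalue.
    number-component : ∀ L w f → number L (component L w f) ≋ λ x → fromℕ w * component L w f x
    number-component []      zero    f x = sym (zeroˡ _)
    number-component []      (suc w) f x = sym (zeroʳ _)
    number-component (i ∷ L) zero    f x = begin
      E⊥ i (component L 0 (E i f)) x + number L (component L 0 (E i f)) x
        ≈⟨ +-cong (T-E⊥ c i (E i f) x) refl ⟨
      component L 0 (E⊥ i (E i f)) x + number L (component L 0 (E i f)) x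
        ≈⟨ +-cong (T-0 c (E⊥-fixed i (E-idem i f)) x) (number-component L 0 (E i f) x) ⟩
      0# + 0# * component L 0 (E i f) x
        ≈⟨ +-identityˡ _ ⟩
      0# * component L 0 (E i f) x
        ∎
      where c = component-commutant L 0
    number-component (i ∷ L) (suc w) f x = begin
      number (i ∷ L) (λ y → A y + B y) x
        ≈⟨ T-+ (number-commutant (i ∷ L)) A B x ⟩
      (E⊥ i A x + number L A x) + (E⊥ i B x + number L B x)
        ≈⟨ +-cong (+-cong E⊥A (number-component L (suc w) (E i f) x))
                  (+-cong E⊥B (number-component L w (E⊥ i f) x)) ⟩
      (0# + (1# + fromℕ w) * A x) + (B x + fromℕ w * B x)
        ≈⟨ +-cong (+-identityˡ _) (trans (+-congʳ (sym (*-identityˡ (B x)))) (sym (distribʳ (B x) 1# (fromℕ w)))) ⟩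
      (1# + fromℕ w) * A x + (1# + fromℕ w) * B x
        ≈⟨ distribˡ (1# + fromℕ w) (A x) (B x) ⟨
      (1# + fromℕ w) * (A x + B x)
        ∎
      where
      A B : X → Carrier
      A = component L (suc w) (E i f)
      B = component L w (E⊥ i f)

      E⊥A : E⊥ i A x ≈ 0#
      E⊥A = trans (sym (T-E⊥ (component-commutant L (suc w)) i (E i f) x))
        (T-0 (component-commutant L (suc w)) (E⊥-fixed i (E-idem i f)) x)

      E⊥B : E⊥ i B x ≈ B x
      E⊥B = trans (sym (T-E⊥ (component-commutant L w) i (E⊥ i f) x))
        (T-cong (component-commutant L w) (E⊥-E⊥ i f) x)

    -- Each term of the component is a product of `E⊥` over some `S` of length w, applied to the
    -- average over the remaining coordinates `R`. In the recursion a factor `E i` moves `i` into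
    -- `R`; a factor `E⊥ i` moves it into `S` and uses up one unit of `s`.
    component-null : ∀ L s f →
      (∀ S R → S ++ R ↭ L → length S ≤ s → average R f ≋ λ _ → 0#) →
      ∀ w → w ≤ s → component L w f ≋ λ _ → 0#
    component-null []      s f h zero    w≤s x = h [] [] ↭.refl z≤n x
    component-null []      s f h (suc w) w≤s x = refl
    component-null (i ∷ L) s f h w w≤s = go w w≤s
      where
      hE : ∀ S R → S ++ R ↭ L → length S ≤ s → average R (E i f) ≋ λ _ → 0#
      hE S R p S≤s x = trans (T-E (average-commutant R) i f x)
        (h S (i ∷ R) (↭.trans (shift i S R) (prep i p)) S≤s x)

      go : ∀ w → w ≤ s → component (i ∷ L) w f ≋ λ _ → 0#
      go zero    w≤s       x = component-null L s (E i f) hE zero w≤s x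
      go (suc w) (s≤s {n = s′} w≤s) x = trans
        (+-cong (component-null L s (E i f) hE (suc w) (s≤s w≤s) x)
                (component-null L s′ (E⊥ i f) hE⊥ w w≤s x))
        (+-identityˡ 0#)
        where
        hE⊥ : ∀ S R → S ++ R ↭ L → length S ≤ s′ → average R (E⊥ i f) ≋ λ _ → 0#
        hE⊥ S R p S≤s′ x = trans (T-E⊥ (average-commutant R) i f x)
          (T-0 (E⊥-commutant i) (h (i ∷ S) R (prep i p) (s≤s S≤s′)) x)

    -- As long as only factors `E` are chosen, averages stay constant. The first factor `E⊥`,
    -- present because w ≥ 1, turns these constants into 0, and `component-null` takes over.
    component-vanish : ∀ L s f →
      (∀ S R → S ++ R ↭ L → length S ≤ s → Constant (average R f)) →
      ∀ w → 1 ≤ w → w ≤ s → component L w f ≋ λ _ → 0#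
    component-vanish []      s       f h (suc w) _ _         x = refl
    component-vanish (i ∷ L) (suc s) f h (suc w) _ (s≤s w≤s) x = trans
      (+-cong (component-vanish L (suc s) (E i f) hE (suc w) (s≤s z≤n) (s≤s w≤s) x)
              (component-null L s (E⊥ i f) hE⊥ w w≤s x))
      (+-identityˡ 0#)
      where
      hE : ∀ S R → S ++ R ↭ L → length S ≤ suc s → Constant (average R (E i f))
      hE S R p S≤s = Constant-resp (λ y → sym (T-E (average-commutant R) i f y))
        (h S (i ∷ R) (↭.trans (shift i S R) (prep i p)) S≤s)

      hE⊥ : ∀ S R → S ++ R ↭ L → length S ≤ s → average R (E⊥ i f) ≋ λ _ → 0#
      hE⊥ S R p S≤s y = trans (T-E⊥ (average-commutant R) i f y)
        (E⊥-fixed i (E-const i (h (i ∷ S) R (prep i p) (s≤s S≤s))) y)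

    module _ (A : IsRationalAlgebra K) where

      open Division K A

      -- Splitting `g` into `E⊥ i g` and `E i g` removes `i` from the list: on the first part `E⊥ i`
      -- is the identity and raises `v` by one, on the second it is zero. The shift `v` is there to
      -- let this induction close; for the empty list v g = w g remains, with v ≠ w.
      number-eigenvalue-range : ∀ L v w g →
        (∀ x → number L g x + fromℕ v * g x ≈ fromℕ w * g x) →
        w < v ⊎ v ℕ.+ length L < w → g ≋ λ _ → 0#
      number-eigenvalue-range [] v w g e (inj₁ w<v) x =
        multiples-separate w<v (sym (trans (sym (+-identityˡ _)) (e x)))
      number-eigenvalue-range [] v w g e (inj₂ v<w) x =
        multiples-separate (≡.subst (_< w) (ℕ.+-identityʳ v) v<w) (trans (sym (+-identityˡ _)) (e x))
      number-eigenvalue-range (i ∷ L) v w g e out x = begin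
        g x                  ≈⟨ E⊥+E i g x ⟨
        E⊥ i g x + E i g x   ≈⟨ +-cong (number-eigenvalue-range L (suc v) w (E⊥ i g) e⊥ (out⊥ out) x)
                                       (number-eigenvalue-range L v w (E i g) eE (outE out) x) ⟩
        0# + 0#              ≈⟨ +-identityˡ 0# ⟩
        0#                   ∎
        where
        -- The summand `T (E⊥ i g)` is kept apart from the rest of `number`: it becomes `E⊥ i g` for
        -- `T = E⊥ i` and 0 for `T = E i`.
        transported : ∀ {T} → InCommutant T → ∀ x →
          (T (E⊥ i g) x + number L (T g) x) + fromℕ v * T g x ≈ fromℕ w * T g x
        transported {T} a x = begin
          (T (E⊥ i g) x + number L (T g) x) + fromℕ v * T g x
            ≈⟨ +-cong (+-congˡ (number-T a L g x)) (sym (T-* a (fromℕ v) g x)) ⟩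
          (T (E⊥ i g) x + T (number L g) x) + T (λ y → fromℕ v * g y) x
            ≈⟨ +-congʳ (T-+ a _ _ x) ⟨
          T (number (i ∷ L) g) x + T (λ y → fromℕ v * g y) x
            ≈⟨ T-+ a _ _ x ⟨
          T (λ y → number (i ∷ L) g y + fromℕ v * g y) x
            ≈⟨ T-cong a e x ⟩
          T (λ y → fromℕ w * g y) x
            ≈⟨ T-* a (fromℕ w) g x ⟩
          fromℕ w * T g x
            ∎

        e⊥ : ∀ x → number L (E⊥ i g) x + fromℕ (suc v) * E⊥ i g x ≈ fromℕ w * E⊥ i g x
        e⊥ x = begin
          number L (E⊥ i g) x + (1# + fromℕ v) * E⊥ i g x
            ≈⟨ +-congˡ (trans (distribʳ _ 1# (fromℕ v)) (+-congʳ (*-identityˡ _))) ⟩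
          number L (E⊥ i g) x + (E⊥ i g x + fromℕ v * E⊥ i g x)
            ≈⟨ x∙yz≈y∙xz _ _ _ ⟩
          E⊥ i g x + (number L (E⊥ i g) x + fromℕ v * E⊥ i g x)
            ≈⟨ +-assoc _ _ _ ⟨
          (E⊥ i g x + number L (E⊥ i g) x) + fromℕ v * E⊥ i g x
            ≈⟨ +-congʳ (+-congʳ (E⊥-E⊥ i g x)) ⟨
          (E⊥ i (E⊥ i g) x + number L (E⊥ i g) x) + fromℕ v * E⊥ i g x
            ≈⟨ transported (E⊥-commutant i) x ⟩
          fromℕ w * E⊥ i g x
            ∎

        eE : ∀ x → number L (E i g) x + fromℕ v * E i g x ≈ fromℕ w * E i g x
        eE x = begin
          number L (E i g) x + fromℕ v * E i g x
            ≈⟨ +-congʳ (trans (+-congʳ (E-E⊥ i g x)) (+-identityˡ _)) ⟨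
          (E i (E⊥ i g) x + number L (E i g) x) + fromℕ v * E i g x
            ≈⟨ transported (E-commutant i) x ⟩
          fromℕ w * E i g x
            ∎

        out⊥ : w < v ⊎ v ℕ.+ suc (length L) < w → w < suc v ⊎ suc v ℕ.+ length L < w
        out⊥ (inj₁ w<v) = inj₁ (ℕ.m<n⇒m<1+n w<v)
        out⊥ (inj₂ v<w) = inj₂ (≡.subst (_< w) (ℕ.+-suc v (length L)) v<w)

        outE : w < v ⊎ v ℕ.+ suc (length L) < w → w < v ⊎ v ℕ.+ length L < w
        outE (inj₁ w<v) = inj₁ w<v
        outE (inj₂ v<w) = inj₂ (ℕ.≤-<-trans (ℕ.+-monoʳ-≤ v (ℕ.n≤1+n (length L))) v<w)

      -- On the range of E⊥ i the equation number (i ∷ L) g = 0 turns into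
      -- number L g = −g, but −1 is not an eigenvalue of number L.
      number-kernel : ∀ L {g} → number L g ≋ (λ _ → 0#) → ∀ {i} → i ∈ L → E i g ≋ g
      number-kernel (j ∷ L) {g} e {i} = go
        where
        E⊥g≋0 : E⊥ j g ≋ λ _ → 0#
        E⊥g≋0 = number-eigenvalue-range L 1 0 (E⊥ j g) shifted (inj₁ (s≤s z≤n))
          where
          shifted : ∀ x → number L (E⊥ j g) x + fromℕ 1 * E⊥ j g x ≈ fromℕ 0 * E⊥ j g x
          shifted x = begin
            number L (E⊥ j g) x + fromℕ 1 * E⊥ j g x
              ≈⟨ +-cong (number-T (E⊥-commutant j) L g x) (trans (*-congʳ fromℕ-1) (*-identityˡ _)) ⟩
            E⊥ j (number L g) x + E⊥ j g x
              ≈⟨ +-comm _ _ ⟩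
            E⊥ j g x + E⊥ j (number L g) x
              ≈⟨ +-congʳ (E⊥-E⊥ j g x) ⟨
            E⊥ j (E⊥ j g) x + E⊥ j (number L g) x
              ≈⟨ T-+ (E⊥-commutant j) _ _ x ⟨
            E⊥ j (number (j ∷ L) g) x
              ≈⟨ T-0 (E⊥-commutant j) e x ⟩
            0#
              ≈⟨ zeroˡ _ ⟨
            0# * E⊥ j g x
              ∎

        go : i ∈ j ∷ L → E i g ≋ g
        go (here ≡.refl) x = trans (sym (trans (+-congʳ (E⊥g≋0 x)) (+-identityˡ _))) (E⊥+E j g x)
        go (there i∈)      =
          number-kernel L (λ x → trans (sym (trans (+-congʳ (E⊥g≋0 x)) (+-identityˡ _))) (e x)) i∈

-- Lists without repetitions

unique-++⁻ : ∀ {A : Set} (xs : List A) {ys} → Unique (xs ++ ys) →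
  Unique xs × Unique ys × (∀ {x} → x ∈ xs → x ∉ ys)
unique-++⁻ []       u           = [] , u , λ ()
unique-++⁻ (x ∷ xs) u@(x∉ ∷ u′) with unique-++⁻ xs u′
... | uxs , uys , disjoint = ListAll.++⁻ˡ xs x∉ ∷ uxs , uys , λ
  { (here ≡.refl) x∈ys → Unique[x∷xs]⇒x∉xs u (∈-++⁺ʳ xs x∈ys)
  ; (there x∈xs)  x∈ys → disjoint x∈xs x∈ys
  }

lookup-injective : ∀ {A : Set} {xs : List A} → Unique xs → Injective _≡_ _≡_ (List.lookup xs)
lookup-injective {xs = x ∷ xs} u       {Fin.zero}  {Fin.zero}  e = ≡.refl
lookup-injective {xs = x ∷ xs} u       {Fin.zero}  {Fin.suc j} e =
  ⊥-elim (Unique[x∷xs]⇒x∉xs u (≡.subst (_∈ xs) (≡.sym e) (∈-lookup j)))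
lookup-injective {xs = x ∷ xs} u       {Fin.suc i} {Fin.zero}  e =
  ⊥-elim (Unique[x∷xs]⇒x∉xs u (≡.subst (_∈ xs) e (∈-lookup i)))
lookup-injective {xs = x ∷ xs} (_ ∷ u) {Fin.suc i} {Fin.suc j} e = ≡.cong Fin.suc (lookup-injective u e)

-- Lists without repetitions that have the same members are equal as bags, hence permutations of
-- each other.
complement : ∀ {n} (T : List (Fin n)) → Unique T → ∃[ R ] T ++ R ↭ allFin n
complement {n} T u = R , ∼bag⇒↭ (unique∧set⇒bag
  (++⁺ u (filter⁺ outside? (allFin⁺ n)) λ (i∈T , i∈R) → proj₂ (∈-filter⁻ outside? {xs = allFin n} i∈R) i∈T)
  (allFin⁺ n)
  (mk⇔ (λ _ → ∈-allFin _) (λ _ → member _)))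
  where
  outside? : ∀ i → Dec (i ∉ T)
  outside? i = ¬? (_∈?_ Fin._≟_ i T)

  R : List (Fin n)
  R = filter outside? (allFin n)

  member : ∀ i → i ∈ T ++ R
  member i with _∈?_ Fin._≟_ i T
  ... | yes i∈T = ∈-++⁺ˡ i∈T
  ... | no i∉T  = ∈-++⁺ʳ T (∈-filter⁺ outside? (∈-allFin i) i∉T)

-- A set of coordinates and its complement are encoded by this permutation. It transports sums and
-- lengths directly, and yields disjointness because `allFin n` has no repetitions.
module _ {n} (T R : List (Fin n)) (p : T ++ R ↭ allFin n) where

  split-unique : Unique (T ++ R)
  split-unique = Unique-resp-↭ (≡.setoid (Fin n)) (↭⇒↭ₛ (↭-sym p)) (allFin⁺ n)

  split-disjoint : ∀ {k} → k ∈ T → k ∉ R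
  split-disjoint = proj₂ (proj₂ (unique-++⁻ T split-unique))

  split-cover : ∀ {k} → k ∉ R → k ∈ T
  split-cover {k} k∉R with ∈-++⁻ T (∈-resp-↭ (↭-sym p) (∈-allFin k))
  ... | inj₁ k∈T = k∈T
  ... | inj₂ k∈R = ⊥-elim (k∉R k∈R)

  split-length : length T ℕ.+ length R ≡ n
  split-length = ≡.trans (≡.sym (List.length-++ T)) (≡.trans (↭-length p) (List.length-tabulate (λ i → i)))

-- Words

infixl 9 _[_≔_]

_[_≔_] : ∀ {n} {q : Vec ℕ n} → Word q → (i : Fin n) → Fin (lookup q i) → Word q
(_ ∷ x) [ Fin.zero  ≔ a ] = a ∷ x
(b ∷ x) [ Fin.suc i ≔ a ] = b ∷ x [ i ≔ a ]

‼-update : ∀ {n} {q : Vec ℕ n} (x : Word q) i a → x [ i ≔ a ] ‼ i ≡ a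
‼-update (_ ∷ x) Fin.zero    a = ≡.refl
‼-update (_ ∷ x) (Fin.suc i) a = ‼-update x i a

‼-update-other : ∀ {n} {q : Vec ℕ n} (x : Word q) {i j} a → j ≢ i → x [ i ≔ a ] ‼ j ≡ x ‼ j
‼-update-other (_ ∷ x) {Fin.zero}  {Fin.zero}  a j≢i = ⊥-elim (j≢i ≡.refl)
‼-update-other (_ ∷ x) {Fin.zero}  {Fin.suc j} a j≢i = ≡.refl
‼-update-other (_ ∷ x) {Fin.suc i} {Fin.zero}  a j≢i = ≡.refl
‼-update-other (_ ∷ x) {Fin.suc i} {Fin.suc j} a j≢i = ‼-update-other x a (j≢i ∘ ≡.cong Fin.suc)

update-update : ∀ {n} {q : Vec ℕ n} (x : Word q) i a b → x [ i ≔ a ] [ i ≔ b ] ≡ x [ i ≔ b ]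
update-update (_ ∷ x) Fin.zero    a b = ≡.refl
update-update (c ∷ x) (Fin.suc i) a b = ≡.cong (c ∷_) (update-update x i a b)

update-comm : ∀ {n} {q : Vec ℕ n} (x : Word q) {i j} a b → i ≢ j →
  x [ i ≔ a ] [ j ≔ b ] ≡ x [ j ≔ b ] [ i ≔ a ]
update-comm (_ ∷ x) {Fin.zero}  {Fin.zero}  a b i≢j = ⊥-elim (i≢j ≡.refl)
update-comm (_ ∷ x) {Fin.zero}  {Fin.suc j} a b i≢j = ≡.refl
update-comm (_ ∷ x) {Fin.suc i} {Fin.zero}  a b i≢j = ≡.refl
update-comm (c ∷ x) {Fin.suc i} {Fin.suc j} a b i≢j = ≡.cong (c ∷_) (update-comm x a b (i≢j ∘ ≡.cong Fin.suc))

‼-ext : ∀ {n} {q : Vec ℕ n} {x y : Word q} → (∀ i → x ‼ i ≡ y ‼ i) → x ≡ y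
‼-ext {x = []}    {[]}    e = ≡.refl
‼-ext {x = a ∷ x} {b ∷ y} e = ≡.cong₂ _∷_ (e Fin.zero) (‼-ext (e ∘ Fin.suc))

‼-lookup⁻ : ∀ {n} (q : Vec ℕ n) (g : ∀ i → Fin (lookup q i)) i → _‼_ {q = q} (lookup⁻ g) i ≡ g i
‼-lookup⁻ (_ Vec.∷ q) g Fin.zero    = ≡.refl
‼-lookup⁻ (_ Vec.∷ q) g (Fin.suc i) = ‼-lookup⁻ q (g ∘ Fin.suc) i

-- The scheme H(q₁⋯qₙ)

module Hamming (K : CommutativeRing 0ℓ 0ℓ) (A : IsRationalAlgebra K)
               {n : ℕ} (q : Vec ℕ n) (pos : ∀ i → 1 ≤ lookup q i) (lcms-pos : 1 ≤ lcms q) where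

  open CommutativeRing K hiding (zero)
  open Spectral K
  open FiniteSums K
  open Division K A
  open IsRationalAlgebra A
  open Projections K (Word q)
  open CommutativeSemigroupProperties *-commutativeSemigroup using () renaming (x∙yz≈y∙xz to x*yz≈y*xz)
  open SemiringSolver commutativeSemiring using (solve; _:=_; _:+_; _:*_)
  open import Relation.Binary.Reasoning.Setoid setoid

  -- Supplies a point at which an average can be evaluated to give a prescribed count. Injectivity
  -- makes the prescription consistent: the search for an index mapped to `i j` can only return `j`.
  word-with : ∀ {t} (i : Fin t → Fin n) → Injective _≡_ _≡_ i → (a : ∀ j → Fin (lookup q (i j))) →
    Σ[ x ∈ Word q ] (∀ j → x ‼ i j ≡ a j)
  word-with i injective a = lookup⁻ (λ k → letter (Fin.any? λ j → i j Fin.≟ k))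
    , λ j → ≡.trans (‼-lookup⁻ q _ (i j)) (letter-i j (Fin.any? λ j′ → i j′ Fin.≟ i j))
    where
    letter : ∀ {k} → Dec (∃[ j ] i j ≡ k) → Fin (lookup q k)
    letter     (yes (j , ≡.refl)) = a j
    -- Coordinates outside the image of `i` get the default letter 0, which exists because alphabets
    -- are nonempty.
    letter {k} (no _)             = Fin.fromℕ< (pos k)

    letter-i : ∀ j (d : Dec (∃[ j′ ] i j′ ≡ i j)) → letter d ≡ a j
    letter-i j (yes (j′ , e)) with injective e
    letter-i j (yes (j  , ≡.refl)) | ≡.refl = ≡.refl
    letter-i j (no ¬d)             = ⊥-elim (¬d (j , ≡.refl))

  coordinateSum : Fin n → (Word q → Carrier) → Word q → Carrier
  coordinateSum i f x = sumᴷ (allFin (lookup q i)) (λ a → f (x [ i ≔ a ]))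

  coordinateMean : Fin n → (Word q → Carrier) → Word q → Carrier
  coordinateMean i f x = inv (lookup q i) * coordinateSum i f x

  coordinateMean-* : ∀ i f x → fromℕ (lookup q i) * coordinateMean i f x ≈ coordinateSum i f x
  coordinateMean-* i f x = begin
    fromℕ (lookup q i) * (inv (lookup q i) * coordinateSum i f x)  ≈⟨ x*yz≈y*xz _ _ _ ⟩
    inv (lookup q i) * (fromℕ (lookup q i) * coordinateSum i f x)  ≈⟨ inv-* _ (pos i) _ ⟩
    coordinateSum i f x                                            ∎

  coordinateMean-fixed : ∀ i f x → (∀ a → f (x [ i ≔ a ]) ≈ f x) → coordinateMean i f x ≈ f x
  coordinateMean-fixed i f x e = begin
    inv (lookup q i) * coordinateSum i f x
      ≈⟨ *-congˡ (sum-cong (allFin (lookup q i)) λ {a} _ → e a) ⟩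
    inv (lookup q i) * sumᴷ (allFin (lookup q i)) (λ _ → f x)
      ≈⟨ *-congˡ (sum-const (allFin (lookup q i)) (f x)) ⟩
    inv (lookup q i) * (fromℕ (length (allFin (lookup q i))) * f x)
      ≡⟨ ≡.cong (λ l → inv (lookup q i) * (fromℕ l * f x)) (List.length-tabulate {n = lookup q i} (λ a → a)) ⟩
    inv (lookup q i) * (fromℕ (lookup q i) * f x)
      ≈⟨ inv-* _ (pos i) (f x) ⟩
    f x
      ∎

  coordinateMean-twice : ∀ i j f x → coordinateMean i (coordinateMean j f) x ≈
    inv (lookup q i) * inv (lookup q j) *
      sumᴷ (allFin (lookup q i)) (λ a → sumᴷ (allFin (lookup q j)) (λ b → f (x [ i ≔ a ] [ j ≔ b ])))
  coordinateMean-twice i j f x = trans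
    (*-congˡ (sum-*ˡ (allFin (lookup q i)) (inv (lookup q j)) (λ a → coordinateSum j f (x [ i ≔ a ]))))
    (sym (*-assoc _ _ _))

  coordinateMean-comm : ∀ i j f x →
    coordinateMean i (coordinateMean j f) x ≈ coordinateMean j (coordinateMean i f) x
  coordinateMean-comm i j f x with i Fin.≟ j
  ... | yes ≡.refl = refl
  ... | no i≢j     = begin
    coordinateMean i (coordinateMean j f) x
      ≈⟨ coordinateMean-twice i j f x ⟩
    inv (lookup q i) * inv (lookup q j) *
      sumᴷ (allFin (lookup q i)) (λ a → sumᴷ (allFin (lookup q j)) (λ b → f (x [ i ≔ a ] [ j ≔ b ])))
      ≈⟨ *-cong (*-comm _ _) (sum-swap (allFin (lookup q i)) (allFin (lookup q j)) _) ⟩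
    inv (lookup q j) * inv (lookup q i) *
      sumᴷ (allFin (lookup q j)) (λ b → sumᴷ (allFin (lookup q i)) (λ a → f (x [ i ≔ a ] [ j ≔ b ])))
      ≈⟨ *-congˡ (sum-cong (allFin (lookup q j)) λ {b} _ → sum-cong (allFin (lookup q i)) λ {a} _ →
           reflexive (≡.cong f (update-comm x a b i≢j))) ⟩
    inv (lookup q j) * inv (lookup q i) *
      sumᴷ (allFin (lookup q j)) (λ b → sumᴷ (allFin (lookup q i)) (λ a → f (x [ j ≔ b ] [ i ≔ a ])))
      ≈⟨ coordinateMean-twice j i f x ⟨
    coordinateMean j (coordinateMean i f) x
      ∎

  projections : CommutingProjections (Fin n)
  projections = record
    { E = coordinateMean
    ; E-cong = λ i e x → *-congˡ (sum-cong (allFin (lookup q i)) (λ _ → e _))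
    ; E-+ = λ i f g x → trans (*-congˡ (sum-+ (allFin (lookup q i)) (λ a → f (x [ i ≔ a ])) (λ a → g (x [ i ≔ a ])))) (distribˡ _ _ _)
    ; E-* = λ i c f x → trans (*-congˡ (sum-*ˡ (allFin (lookup q i)) c (λ a → f (x [ i ≔ a ])))) (x*yz≈y*xz _ _ _)
    ; E-idem = λ i f x → coordinateMean-fixed i (coordinateMean i f) x λ a →
        *-congˡ (sum-cong (allFin (lookup q i)) λ {b} _ → reflexive (≡.cong f (update-update x i a b)))
    ; E-comm = coordinateMean-comm
    ; E-const = λ i {f} c x → coordinateMean-fixed i f x (λ a → c _ x)
    }

  open ProjectionAlgebra projections

  AgreeOff : List (Fin n) → Word q → Word q → Set
  AgreeOff R x y = ∀ k → k ∉ R → x ‼ k ≡ y ‼ k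

  agreeOff? : ∀ R x y → Dec (AgreeOff R x y)
  agreeOff? R x y = Fin.all? λ k → ¬? (_∈?_ Fin._≟_ k R) →-dec (x ‼ k Fin.≟ y ‼ k)

  size : List (Fin n) → ℕ
  size R = List.foldr ℕ._*_ 1 (List.map (lookup q) R)

  size-++ : ∀ T R → size (T ++ R) ≡ size T ℕ.* size R
  size-++ []      R = ≡.sym (ℕ.*-identityˡ _)
  size-++ (i ∷ T) R = ≡.trans (≡.cong (lookup q i ℕ.*_) (size-++ T R)) (≡.sym (ℕ.*-assoc (lookup q i) _ _))

  size-pos : ∀ R → 1 ≤ size R
  size-pos []      = s≤s z≤n
  size-pos (i ∷ R) = ℕ.*-mono-≤ (pos i) (size-pos R)

  AgreeOff-∷ : ∀ {i R} x y {a} → i ∉ R → AgreeOff R (x [ i ≔ a ]) y → AgreeOff (i ∷ R) x y × a ≡ y ‼ i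
  AgreeOff-∷ {i} {R} x y {a} i∉R h =
    (λ k k∉ → ≡.trans (≡.sym (‼-update-other x a (λ e → k∉ (here e)))) (h k (λ k∈R → k∉ (there k∈R))))
    , ≡.trans (≡.sym (‼-update x i a)) (h i i∉R)

  AgreeOff-update : ∀ {i R} x y → AgreeOff (i ∷ R) x y → AgreeOff R (x [ i ≔ y ‼ i ]) y
  AgreeOff-update {i} {R} x y h k k∉R with k Fin.≟ i
  ... | yes ≡.refl = ‼-update x i (y ‼ i)
  ... | no k≢i     = ≡.trans (‼-update-other x (y ‼ i) k≢i)
    (h k λ { (here e) → k≢i e ; (there k∈R) → k∉R k∈R })

  -- Since i ∉ R, agreement off `R` forces a = y ‼ i, so at most one term is nonzero; that one is 1
  -- exactly when `x` and `y` agree off `i ∷ R`.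
  sum-agreeOff-update : ∀ {i R} → i ∉ R → ∀ x y →
    sumᴷ (allFin (lookup q i)) (λ a → indicator (agreeOff? R (x [ i ≔ a ]) y)) ≈ indicator (agreeOff? (i ∷ R) x y)
  sum-agreeOff-update {i} {R} i∉R x y with agreeOff? (i ∷ R) x y
  ... | yes h = trans (sum-cong (allFin (lookup q i)) (λ _ → sym (*-identityʳ _)))
    (sum-indicator-singleton (λ a → agreeOff? R (x [ i ≔ a ]) y) (allFin⁺ (lookup q i)) (∈-allFin (y ‼ i))
      (AgreeOff-update x y h) (λ h′ → proj₂ (AgreeOff-∷ x y i∉R h′)) (λ _ → 1#))
  ... | no ¬h = sum-vanish (allFin (lookup q i)) λ {a} _ →
    indicator-no (agreeOff? R (x [ i ≔ a ]) y) (λ h′ → ¬h (proj₁ (AgreeOff-∷ x y i∉R h′)))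

  -- The link from operators to counting and to adjacency: `average R` is the mean over the words
  -- agreeing with `x` off `R`, and `size R` is their number. A repeated coordinate would multiply
  -- `size` without enlarging this fibre.
  average-sum : ∀ R → Unique R → ∀ f x →
    fromℕ (size R) * average R f x ≈ sumᴷ (words q) (λ y → indicator (agreeOff? R x y) * f y)
  average-sum [] u f x = begin
    fromℕ 1 * f x  ≈⟨ trans (*-congʳ fromℕ-1) (*-identityˡ (f x)) ⟩
    f x            ≈⟨ sum-indicator-singleton (agreeOff? [] x) (words-unique q) (words-complete q x)
                        (λ _ _ → ≡.refl) (λ h → ≡.sym (‼-ext (λ k → h k (λ ())))) f ⟨
    sumᴷ (words q) (λ y → indicator (agreeOff? [] x y) * f y)  ∎
  average-sum (i ∷ R) u@(_ ∷ u′) f x = begin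
    fromℕ (lookup q i ℕ.* size R) * coordinateMean i (average R f) x
      ≈⟨ *-congʳ (trans (fromℕ-* (lookup q i) (size R)) (*-comm _ _)) ⟩
    fromℕ (size R) * fromℕ (lookup q i) * coordinateMean i (average R f) x
      ≈⟨ *-assoc _ _ _ ⟩
    fromℕ (size R) * (fromℕ (lookup q i) * coordinateMean i (average R f) x)
      ≈⟨ *-congˡ (coordinateMean-* i (average R f) x) ⟩
    fromℕ (size R) * coordinateSum i (average R f) x
      ≈⟨ sum-*ˡ (allFin (lookup q i)) _ _ ⟨
    sumᴷ (allFin (lookup q i)) (λ a → fromℕ (size R) * average R f (x [ i ≔ a ]))
      ≈⟨ sum-cong (allFin (lookup q i)) (λ {a} _ → average-sum R u′ f (x [ i ≔ a ])) ⟩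
    sumᴷ (allFin (lookup q i)) (λ a → sumᴷ (words q) (λ y → indicator (agreeOff? R (x [ i ≔ a ]) y) * f y))
      ≈⟨ sum-swap (allFin (lookup q i)) (words q) _ ⟩
    sumᴷ (words q) (λ y → sumᴷ (allFin (lookup q i)) (λ a → indicator (agreeOff? R (x [ i ≔ a ]) y) * f y))
      ≈⟨ sum-cong (words q) (λ {y} _ → trans (sum-*ʳ (allFin (lookup q i)) (f y) _)
           (*-congʳ (sum-agreeOff-update (Unique[x∷xs]⇒x∉xs u) x y))) ⟩
    sumᴷ (words q) (λ y → indicator (agreeOff? (i ∷ R) x y) * f y)
      ∎

  average-full : ∀ L → Unique L → (∀ k → k ∈ L) → ∀ f x → fromℕ (size L) * average L f x ≈ sumᴷ (words q) f
  average-full L u full f x = trans (average-sum L u f x)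
    (sum-cong (words q) λ {y} _ → trans
      (*-congʳ (indicator-yes (agreeOff? L x y) (λ k k∉L → ⊥-elim (k∉L (full k)))))
      (*-identityˡ (f y)))

  split-full : ∀ T R → T ++ R ↭ allFin n → ∀ k → k ∈ T ++ R
  split-full T R p k = ∈-resp-↭ (↭-sym p) (∈-allFin k)

  -- The spectrum

  -- At most one position can be the only one where `x` and `y` differ. The search thus becomes a
  -- sum over positions, which can be exchanged with the sum over words.
  fromℕ-edgeMultiplicity : ∀ x y → fromℕ (edgeMultiplicity q x y) ≈
    sumᴷ (allFin n) (λ i → indicator (differOnlyAt? q x y i) * fromℕ (edgeWeight q i))
  fromℕ-edgeMultiplicity x y with Fin.any? (differOnlyAt? q x y)
  ... | yes (i , d , e) = sym (sum-indicator-singleton (differOnlyAt? q x y) (allFin⁺ n) (∈-allFin i) (d , e) only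
    (λ i → fromℕ (edgeWeight q i)))
    where
    only : ∀ {j} → DifferOnlyAt q x y j → j ≡ i
    only {j} (d′ , _) with j Fin.≟ i
    ... | yes j≡i = j≡i
    ... | no j≢i  = ⊥-elim (d′ (e j j≢i))
  ... | no ¬p = sym (sum-vanish (allFin n) λ {i} _ →
    trans (*-congʳ (indicator-no (differOnlyAt? q x y i) (λ d → ¬p (i , d)))) (zeroˡ _))

  -- The words agreeing with `x` off `i` are `x` itself, expressed as agreement off the empty list,
  -- and those differing from it only at `i`.
  indicator-differOnlyAt : ∀ x y i →
    indicator (differOnlyAt? q x y i) + indicator (agreeOff? [] x y) ≈ indicator (agreeOff? (i ∷ []) x y)
  indicator-differOnlyAt x y i = go (x ‼ i Fin.≟ y ‼ i)
    where
    extend : x ‼ i ≡ y ‼ i → AgreeOff (i ∷ []) x y → AgreeOff [] x y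
    extend xᵢ≡yᵢ h k _ with k Fin.≟ i
    ... | yes ≡.refl = xᵢ≡yᵢ
    ... | no k≢i     = h k λ { (here e) → k≢i e }

    go : Dec (x ‼ i ≡ y ‼ i) →
      indicator (differOnlyAt? q x y i) + indicator (agreeOff? [] x y) ≈ indicator (agreeOff? (i ∷ []) x y)
    go (yes xᵢ≡yᵢ) = trans
      (+-cong (indicator-no (differOnlyAt? q x y i) (λ (d , _) → d xᵢ≡yᵢ))
              (indicator-cong (agreeOff? [] x y) (agreeOff? (i ∷ []) x y) (λ h k _ → h k (λ ())) (extend xᵢ≡yᵢ)))
      (+-identityˡ _)
    go (no xᵢ≢yᵢ) = trans
      (+-cong (indicator-cong (differOnlyAt? q x y i) (agreeOff? (i ∷ []) x y)
                (λ (_ , h) k k∉ → h k (λ e → k∉ (here e)))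
                (λ h → xᵢ≢yᵢ , λ k k≢i → h k λ { (here e) → k≢i e }))
              (indicator-no (agreeOff? [] x y) (λ h → xᵢ≢yᵢ (h i (λ ())))))
      (+-identityʳ _)

  sum-differOnlyAt : ∀ i f x →
    sumᴷ (words q) (λ y → indicator (differOnlyAt? q x y i) * f y) + f x ≈ fromℕ (lookup q i) * coordinateMean i f x
  sum-differOnlyAt i f x = begin
    sumᴷ (words q) (λ y → indicator (differOnlyAt? q x y i) * f y) + f x
      ≈⟨ +-congˡ (trans (sym (trans (*-congʳ fromℕ-1) (*-identityˡ (f x)))) (average-sum [] [] f x)) ⟩
    sumᴷ (words q) (λ y → indicator (differOnlyAt? q x y i) * f y) + sumᴷ (words q) (λ y → indicator (agreeOff? [] x y) * f y)
      ≈⟨ sum-+ (words q) _ _ ⟨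
    sumᴷ (words q) (λ y → indicator (differOnlyAt? q x y i) * f y + indicator (agreeOff? [] x y) * f y)
      ≈⟨ sum-cong (words q) (λ {y} _ → trans (sym (distribʳ (f y) _ _)) (*-congʳ (indicator-differOnlyAt x y i))) ⟩
    sumᴷ (words q) (λ y → indicator (agreeOff? (i ∷ []) x y) * f y)
      ≈⟨ average-sum (i ∷ []) (ListAll.[] ∷ []) f x ⟨
    fromℕ (lookup q i ℕ.* 1) * coordinateMean i f x
      ≡⟨ ≡.cong (λ m → fromℕ m * coordinateMean i f x) (ℕ.*-identityʳ (lookup q i)) ⟩
    fromℕ (lookup q i) * coordinateMean i f x
      ∎

  edgeWeight-* : ∀ i → edgeWeight q i ℕ.* lookup q i ≡ lcms q
  edgeWeight-* i = ≡.sym (m∣n⇒n≡quotient*m (lookup∣lcms q i))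

  totalWeight : ℕ
  totalWeight = sumℕ (allFin n) (edgeWeight q)

  -- `totalWeight` collects the copies of `f x`, of weight Q / q_i in direction i, that complete the
  -- neighbours to full lines.
  adjacency-mean : ∀ f x → adjacency (H q) f x + fromℕ totalWeight * f x ≈
    fromℕ (lcms q) * sumᴷ (allFin n) (λ i → coordinateMean i f x)
  adjacency-mean f x = begin
    sumᴷ (words q) (λ y → fromℕ (edgeMultiplicity q x y) * f y) + fromℕ totalWeight * f x
      ≈⟨ +-cong
           (sum-cong (words q) λ {y} _ → trans
             (*-congʳ (fromℕ-edgeMultiplicity x y))
             (sym (sum-*ʳ (allFin n) (f y) (λ i → indicator (differOnlyAt? q x y i) * fromℕ (edgeWeight q i)))))
           (trans (*-congʳ (fromℕ-sum (allFin n) (edgeWeight q))) (sym (sum-*ʳ (allFin n) (f x) _))) ⟩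
    sumᴷ (words q) (λ y → sumᴷ (allFin n) (λ i → indicator (differOnlyAt? q x y i) * fromℕ (edgeWeight q i) * f y))
      + sumᴷ (allFin n) (λ i → fromℕ (edgeWeight q i) * f x)
      ≈⟨ +-congʳ (sum-swap (words q) (allFin n) _) ⟩
    sumᴷ (allFin n) (λ i → sumᴷ (words q) (λ y → indicator (differOnlyAt? q x y i) * fromℕ (edgeWeight q i) * f y))
      + sumᴷ (allFin n) (λ i → fromℕ (edgeWeight q i) * f x)
      ≈⟨ sum-+ (allFin n) _ _ ⟨
    sumᴷ (allFin n) (λ i → sumᴷ (words q) (λ y → indicator (differOnlyAt? q x y i) * fromℕ (edgeWeight q i) * f y)
      + fromℕ (edgeWeight q i) * f x)
      ≈⟨ sum-cong (allFin n) (λ {i} _ → coordinate i) ⟩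
    sumᴷ (allFin n) (λ i → fromℕ (lcms q) * coordinateMean i f x)
      ≈⟨ sum-*ˡ (allFin n) _ _ ⟩
    fromℕ (lcms q) * sumᴷ (allFin n) (λ i → coordinateMean i f x)
      ∎
    where
    coordinate : ∀ i →
      sumᴷ (words q) (λ y → indicator (differOnlyAt? q x y i) * fromℕ (edgeWeight q i) * f y)
        + fromℕ (edgeWeight q i) * f x ≈ fromℕ (lcms q) * coordinateMean i f x
    coordinate i = begin
      sumᴷ (words q) (λ y → indicator (differOnlyAt? q x y i) * e * f y) + e * f x
        ≈⟨ +-congʳ (sum-cong (words q) (λ _ → trans (*-congʳ (*-comm _ e)) (*-assoc e _ _))) ⟩
      sumᴷ (words q) (λ y → e * (indicator (differOnlyAt? q x y i) * f y)) + e * f x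
        ≈⟨ +-congʳ (sum-*ˡ (words q) e _) ⟩
      e * sumᴷ (words q) (λ y → indicator (differOnlyAt? q x y i) * f y) + e * f x
        ≈⟨ distribˡ e _ _ ⟨
      e * (sumᴷ (words q) (λ y → indicator (differOnlyAt? q x y i) * f y) + f x)
        ≈⟨ *-congˡ (sum-differOnlyAt i f x) ⟩
      e * (fromℕ (lookup q i) * coordinateMean i f x)
        ≈⟨ *-assoc e _ _ ⟨
      e * fromℕ (lookup q i) * coordinateMean i f x
        ≈⟨ *-congʳ (fromℕ-* (edgeWeight q i) (lookup q i)) ⟨
      fromℕ (edgeWeight q i ℕ.* lookup q i) * coordinateMean i f x
        ≡⟨ ≡.cong (λ m → fromℕ m * coordinateMean i f x) (edgeWeight-* i) ⟩
      fromℕ (lcms q) * coordinateMean i f x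
        ∎
      where e = fromℕ (edgeWeight q i)

  sum-allFin-const : ∀ m c → sumᴷ (allFin m) (λ _ → c) ≈ fromℕ m * c
  sum-allFin-const m c = trans (sum-const (allFin m) c)
    (reflexive (≡.cong (λ l → fromℕ l * c) (List.length-tabulate {n = m} (λ i → i))))

  -- Each coordinate contributes (Q / q_i)(q_i - 1) + Q / q_i = Q; the truncated subtraction is
  -- exact because q_i ≥ 1.
  degree+totalWeight : fromℕ (degree q) + fromℕ totalWeight ≈ fromℕ n * fromℕ (lcms q)
  degree+totalWeight = begin
    fromℕ (degree q) + fromℕ totalWeight
      ≈⟨ +-cong (fromℕ-sum (allFin n) _) (fromℕ-sum (allFin n) _) ⟩
    sumᴷ (allFin n) (λ i → fromℕ (edgeWeight q i ℕ.* (lookup q i ℕ.∸ 1))) + sumᴷ (allFin n) (λ i → fromℕ (edgeWeight q i))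
      ≈⟨ sum-+ (allFin n) _ _ ⟨
    sumᴷ (allFin n) (λ i → fromℕ (edgeWeight q i ℕ.* (lookup q i ℕ.∸ 1)) + fromℕ (edgeWeight q i))
      ≈⟨ sum-cong (allFin n) (λ {i} _ → trans (sym (fromℕ-+ (edgeWeight q i ℕ.* (lookup q i ℕ.∸ 1)) _))
           (reflexive (≡.cong fromℕ (weight i)))) ⟩
    sumᴷ (allFin n) (λ _ → fromℕ (lcms q))
      ≈⟨ sum-allFin-const n _ ⟩
    fromℕ n * fromℕ (lcms q)
      ∎
    where
    weight : ∀ i → edgeWeight q i ℕ.* (lookup q i ℕ.∸ 1) ℕ.+ edgeWeight q i ≡ lcms q
    weight i = ≡.trans (≡.cong (edgeWeight q i ℕ.* (lookup q i ℕ.∸ 1) ℕ.+_) (≡.sym (ℕ.*-identityʳ _)))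
      (≡.trans (≡.sym (ℕ.*-distribˡ-+ (edgeWeight q i) (lookup q i ℕ.∸ 1) 1))
      (≡.trans (≡.cong (edgeWeight q i ℕ.*_) (ℕ.m∸n+n≡m (pos i))) (edgeWeight-* i)))

  θ : Fin (suc n) → Carrier
  θ w = fromℤ (eigenvalue q w)

  open GroupProperties +-group using () renaming (∙-cancelˡ to +-cancelˡ; ∙-cancelʳ to +-cancelʳ)

  -- Adjacency = k − Q · number, arranged so that nothing is subtracted.
  number-adjacency : ∀ w f x → fromℕ (lcms q) * number (allFin n) f x + adjacency (H q) f x ≈
    fromℕ (lcms q) * (fromℕ (toℕ w) * f x) + θ w * f x
  number-adjacency w f x = +-cancelʳ (fromℕ totalWeight * f x) _ _ (begin
    (Q * N + adjacency (H q) f x) + W * f x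
      ≈⟨ trans (+-assoc _ _ _) (+-congˡ (adjacency-mean f x)) ⟩
    Q * N + Q * sumᴷ (allFin n) (λ i → coordinateMean i f x)
      ≈⟨ distribˡ Q N _ ⟨
    Q * (N + sumᴷ (allFin n) (λ i → coordinateMean i f x))
      ≈⟨ *-congˡ (trans (sym (sum-+ (allFin n) _ _))
           (trans (sum-cong (allFin n) (λ {i} _ → E⊥+E i f x)) (sum-allFin-const n (f x)))) ⟩
    Q * (fromℕ n * f x)
      ≈⟨ solve 3 (λ Q n y → Q :* (n :* y) := n :* Q :* y) refl Q (fromℕ n) (f x) ⟩
    fromℕ n * Q * f x
      ≈⟨ *-congʳ degree+totalWeight ⟨
    (fromℕ (degree q) + W) * f x
      ≈⟨ *-congʳ (+-congʳ (trans (sym (fromℤ-− (degree q) (toℕ w ℕ.* lcms q))) (+-congˡ (fromℕ-* (toℕ w) (lcms q))))) ⟩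
    ((θ w + fromℕ (toℕ w) * Q) + W) * f x
      ≈⟨ solve 5 (λ t w Q W y → ((t :+ w :* Q) :+ W) :* y := (Q :* (w :* y) :+ t :* y) :+ W :* y) refl
           (θ w) (fromℕ (toℕ w)) Q W (f x) ⟩
    (Q * (fromℕ (toℕ w) * f x) + θ w * f x) + W * f x
      ∎)
    where
    Q N W : Carrier
    Q = fromℕ (lcms q)
    N = number (allFin n) f x
    W = fromℕ totalWeight

  -- The eigenvalue equation cancels the adjacency term of `number-adjacency` against the term with
  -- `θ w`. What remains carries the factor Q, an invertible positive integer.
  eigenspace⇒number : ∀ w {f} → Eigenspace (H q) (θ w) f → number (allFin n) f ≋ λ x → fromℕ (toℕ w) * f x
  eigenspace⇒number w {f} h x = fromℕ-*-cancelˡ (lcms q) lcms-pos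
    (+-cancelʳ (θ w * f x) _ _ (trans (+-congˡ (sym (h x))) (number-adjacency w f x)))

  number⇒eigenspace : ∀ w {f} → number (allFin n) f ≋ (λ x → fromℕ (toℕ w) * f x) → Eigenspace (H q) (θ w) f
  number⇒eigenspace w {f} h x = +-cancelˡ (fromℕ (lcms q) * number (allFin n) f x) _ _
    (trans (number-adjacency w f x) (+-congʳ (*-congˡ (sym (h x)))))

  -- Orthogonal arrays and designs

  module _ (C : Multiset (Word q)) where

    multiplicityFunction : Word q → Carrier
    multiplicityFunction x = fromℕ (C x)

    -- As `tabulate i` and `R` partition the coordinates, a word has the letters `a` exactly when it
    -- agrees with `x` off `R`, so the count is a sum over a fibre.
    count-average : ∀ {t} (i : Fin t → Fin n) {R} → tabulate i ++ R ↭ allFin n →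
      ∀ a {x} → (∀ j → x ‼ i j ≡ a j) →
      fromℕ (count q C i a) ≈ fromℕ (size R) * average R multiplicityFunction x
    count-average i {R} p a {x} x-a = begin
      fromℕ (count q C i a)
        ≈⟨ fromℕ-sum (filter (λ y → Fin.all? (λ j → y ‼ i j Fin.≟ a j)) (words q)) C ⟩
      sumᴷ (filter (λ y → Fin.all? (λ j → y ‼ i j Fin.≟ a j)) (words q)) multiplicityFunction
        ≈⟨ sum-filter (λ y → Fin.all? (λ j → y ‼ i j Fin.≟ a j)) (words q) multiplicityFunction ⟩
      sumᴷ (words q) (λ y → indicator (Fin.all? (λ j → y ‼ i j Fin.≟ a j)) * multiplicityFunction y)
        ≈⟨ sum-cong (words q) (λ {y} _ → *-congʳ
             (indicator-cong (Fin.all? (λ j → y ‼ i j Fin.≟ a j)) (agreeOff? R x y) (to y) (from y))) ⟩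
      sumᴷ (words q) (λ y → indicator (agreeOff? R x y) * multiplicityFunction y)
        ≈⟨ average-sum R (proj₁ (proj₂ (unique-++⁻ (tabulate i) (split-unique (tabulate i) R p)))) multiplicityFunction x ⟨
      fromℕ (size R) * average R multiplicityFunction x
        ∎
      where
      to : ∀ y → (∀ j → y ‼ i j ≡ a j) → AgreeOff R x y
      to y h k k∉R with ∈-tabulate⁻ (split-cover (tabulate i) R p k∉R)
      ... | j , ≡.refl = ≡.trans (x-a j) (≡.sym (h j))

      from : ∀ y → AgreeOff R x y → ∀ j → y ‼ i j ≡ a j
      from y h j = ≡.trans (≡.sym (h (i j) (split-disjoint (tabulate i) R p (∈-tabulate⁺ j)))) (x-a j)

    fromℕ-card : fromℕ (card q C) ≈ sumᴷ (words q) multiplicityFunction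
    fromℕ-card = fromℕ-sum (words q) C

    size-tabulate : ∀ {t} (i : Fin t → Fin n) →
      List.foldr ℕ._*_ 1 (List.map (λ j → lookup q (i j)) (allFin t)) ≡ size (tabulate i)
    size-tabulate i = ≡.cong (List.foldr ℕ._*_ 1)
      (≡.trans (List.map-tabulate (λ j → j) (lookup q ∘ i)) (≡.sym (List.map-tabulate i (lookup q))))

    fromℕ-size-++ : ∀ T R c → fromℕ (size (T ++ R)) * c ≈ fromℕ (size R) * c * fromℕ (size T)
    fromℕ-size-++ T R c = begin
      fromℕ (size (T ++ R)) * c                ≡⟨ ≡.cong (λ m → fromℕ m * c) (size-++ T R) ⟩
      fromℕ (size T ℕ.* size R) * c            ≈⟨ *-congʳ (fromℕ-* (size T) (size R)) ⟩
      fromℕ (size T) * fromℕ (size R) * c      ≈⟨ solve 3 (λ t r c → t :* r :* c := r :* c :* t) refl _ _ c ⟩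
      fromℕ (size R) * c * fromℕ (size T)      ∎

    -- The letters prescribed are those of `x` itself: the array equation then says that a fixed
    -- positive multiple of the average at `x` is |C|, whatever `x` is.
    orthogonal⇒constant : ∀ {t} → IsOrthogonalArray q t C →
      ∀ T R → T ++ R ↭ allFin n → length T ≡ t → Constant (average R multiplicityFunction)
    orthogonal⇒constant oa T R p ≡.refl x y =
      fromℕ-*-cancelˡ (size (T ++ R)) (size-pos (T ++ R)) (trans (scaled x) (sym (scaled y)))
      where
      i : Fin (length T) → Fin n
      i = List.lookup T

      scaled : ∀ x → fromℕ (size (T ++ R)) * average R multiplicityFunction x ≈ fromℕ (card q C)
      scaled x = begin
        fromℕ (size (T ++ R)) * average R multiplicityFunction x
          ≈⟨ fromℕ-size-++ T R _ ⟩
        fromℕ (size R) * average R multiplicityFunction x * fromℕ (size T)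
          ≈⟨ *-congʳ (count-average i (≡.subst (λ T′ → T′ ++ R ↭ allFin n) (≡.sym (List.tabulate-lookup T)) p)
               (λ j → x ‼ i j) (λ _ → ≡.refl)) ⟨
        fromℕ (count q C i (λ j → x ‼ i j)) * fromℕ (size T)
          ≡⟨ ≡.cong (λ m → fromℕ (count q C i (λ j → x ‼ i j)) * fromℕ m)
               (≡.sym (≡.trans (size-tabulate i) (≡.cong size (List.tabulate-lookup T)))) ⟩
        fromℕ (count q C i (λ j → x ‼ i j)) * fromℕ (List.foldr ℕ._*_ 1 (List.map (λ j → lookup q (i j)) (allFin (length T))))
          ≈⟨ fromℕ-* (count q C i (λ j → x ‼ i j)) _ ⟨
        fromℕ (count q C i (λ j → x ‼ i j) ℕ.* List.foldr ℕ._*_ 1 (List.map (λ j → lookup q (i j)) (allFin (length T))))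
          ≡⟨ ≡.cong fromℕ (oa i (lookup-injective (proj₁ (unique-++⁻ T (split-unique T R p)))) (λ j → x ‼ i j)) ⟩
        fromℕ (card q C)
          ∎

    constant⇒orthogonal : ∀ {t} →
      (∀ T R → T ++ R ↭ allFin n → length T ≡ t → Constant (average R multiplicityFunction)) →
      IsOrthogonalArray q t C
    constant⇒orthogonal constant i injective a
      with complement (tabulate i) (tabulate⁺ injective) | word-with i injective a
    ... | R , p | x , x-a = fromℕ-injective (begin
      fromℕ (count q C i a ℕ.* List.foldr ℕ._*_ 1 (List.map (λ j → lookup q (i j)) (allFin _)))
        ≡⟨ ≡.cong (λ m → fromℕ (count q C i a ℕ.* m)) (size-tabulate i) ⟩
      fromℕ (count q C i a ℕ.* size T)
        ≈⟨ fromℕ-* (count q C i a) (size T) ⟩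
      fromℕ (count q C i a) * fromℕ (size T)
        ≈⟨ *-congʳ (count-average i p a x-a) ⟩
      fromℕ (size R) * average R multiplicityFunction x * fromℕ (size T)
        ≈⟨ fromℕ-size-++ T R _ ⟨
      fromℕ (size (T ++ R)) * average R multiplicityFunction x
        -- The average over `R` is constant, so averaging over `T` as well leaves it unchanged while
        -- turning it into the mean over all words.
        ≈⟨ *-congˡ (trans (average-++ T R multiplicityFunction x)
             (average-constant T (constant T R p (List.length-tabulate i)) x)) ⟨
      fromℕ (size (T ++ R)) * average (T ++ R) multiplicityFunction x
        ≈⟨ average-full (T ++ R) (split-unique T R p) (split-full T R p) multiplicityFunction x ⟩
      sumᴷ (words q) multiplicityFunction
        ≈⟨ fromℕ-card ⟨
      fromℕ (card q C)
        ∎)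
      where
      T : List (Fin n)
      T = tabulate i

    orthogonal⇒design : ∀ {t} → t ≤ n → IsOrthogonalArray q t C → IsAlgebraicDesign (H q) θ t C
    orthogonal⇒design {t} t≤n oa = record
      { φ = λ w → component (allFin n) (toℕ w) multiplicityFunction
      ; φ-eigen = λ w → number⇒eigenspace w (number-component (allFin n) (toℕ w) multiplicityFunction)
      ; decomposition = λ x → sym (sum-component (allFin n) (suc n)
          (s≤s (ℕ.≤-reflexive (List.length-tabulate {n = n} (λ i → i)))) multiplicityFunction x)
      ; φ-vanishes = λ w → component-vanish (allFin n) t multiplicityFunction constant (toℕ w)
      }
      where
      -- R is cut so that its first part completes S to a set of t coordinates;
      -- averaging over that part preserves constancy.
      constant : ∀ S R → S ++ R ↭ allFin n → length S ≤ t → Constant (average R multiplicityFunction)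
      constant S R p S≤t = ≡.subst (λ R → Constant (average R multiplicityFunction)) (List.take++drop≡id k R)
        (Constant-resp (λ x → sym (trans (average-++ R₁ R₂ multiplicityFunction x) (average-constant R₁ constant₂ x))) constant₂)
        where
        k : ℕ
        k = t ℕ.∸ length S

        R₁ R₂ : List (Fin n)
        R₁ = List.take k R
        R₂ = List.drop k R

        -- Here t ≤ n enters: `R` has n - |S| coordinates, enough to bring `S` up to t.
        k≤R : k ≤ length R
        k≤R = ℕ.≤-trans (ℕ.∸-monoˡ-≤ (length S) t≤n)
          (ℕ.≤-reflexive (≡.trans (≡.cong (ℕ._∸ length S) (≡.sym (split-length S R p))) (ℕ.m+n∸m≡n (length S) (length R))))

        length-S++R₁ : length (S ++ R₁) ≡ t
        length-S++R₁ = ≡.trans (List.length-++ S)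
          (≡.trans (≡.cong (length S ℕ.+_) (≡.trans (List.length-take k R) (ℕ.m≤n⇒m⊓n≡m k≤R)))
                   (ℕ.m+[n∸m]≡n S≤t))

        constant₂ : Constant (average R₂ multiplicityFunction)
        constant₂ = orthogonal⇒constant oa (S ++ R₁) R₂
          (≡.subst (_↭ allFin n)
            (≡.sym (≡.trans (List.++-assoc S R₁ R₂) (≡.cong (S ++_) (List.take++drop≡id k R)))) p)
          length-S++R₁

    design⇒orthogonal : ∀ {t} → IsAlgebraicDesign (H q) θ t C → IsOrthogonalArray q t C
    design⇒orthogonal {t} design = constant⇒orthogonal constant
      where
      open IsAlgebraicDesign design

      constant : ∀ T R → T ++ R ↭ allFin n → length T ≡ t → Constant (average R multiplicityFunction)
      constant T R p ≡.refl = Constant-resp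
        (λ x → sym (trans (T-cong aR decomposition x) (T-sum aR (allFin (suc n)) φ x)))
        (λ x y → sum-cong (allFin (suc n)) (λ {w} _ → part w x y))
        where
        open InCommutant

        aR : InCommutant (average R)
        aR = average-commutant R

        -- Weight 0 means lying in the kernel of `number`, so every `E i` fixes this component; it
        -- then equals its mean over all words, which does not depend on the point.
        φ₀-constant : Constant (φ Fin.zero)
        φ₀-constant = Constant-resp fixed (λ x y → fromℕ-*-cancelˡ (size L) (size-pos L)
            (trans (total x) (sym (total y))))
          where
          L : List (Fin n)
          L = allFin n

          fixed : average L (φ Fin.zero) ≋ φ Fin.zero
          fixed = average-fixed L (number-kernel A L
            (λ x → trans (eigenspace⇒number Fin.zero (φ-eigen Fin.zero) x) (zeroˡ _)))

          total : ∀ x → fromℕ (size L) * average L (φ Fin.zero) x ≈ sumᴷ (words q) (φ Fin.zero)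
          total = average-full L (allFin⁺ n) ∈-allFin (φ Fin.zero)

        high : ∀ w → length T < toℕ w → average R (φ w) ≋ λ _ → 0#
        high w T<w = number-eigenvalue-range A T 0 (toℕ w) (average R (φ w)) eigen (inj₂ T<w)
          where
          eigen : ∀ x → number T (average R (φ w)) x + 0# * average R (φ w) x ≈ fromℕ (toℕ w) * average R (φ w) x
          eigen x = begin
            number T (average R (φ w)) x + 0# * average R (φ w) x
              -- The zero term is traded for `number R`, which vanishes on averages over `R`; this
              -- completes the sum over `T` to all coordinates.
              ≈⟨ +-congˡ (trans (zeroˡ _) (sym (number-average R (φ w) x))) ⟩
            number T (average R (φ w)) x + number R (average R (φ w)) x
              ≈⟨ sum-++ T R _ ⟨
            number (T ++ R) (average R (φ w)) x
              ≈⟨ sum-↭ p _ ⟩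
            number (allFin n) (average R (φ w)) x
              ≈⟨ number-T aR (allFin n) (φ w) x ⟩
            average R (number (allFin n) (φ w)) x
              ≈⟨ T-cong aR (eigenspace⇒number w (φ-eigen w)) x ⟩
            average R (λ y → fromℕ (toℕ w) * φ w y) x
              ≈⟨ T-* aR (fromℕ (toℕ w)) (φ w) x ⟩
            fromℕ (toℕ w) * average R (φ w) x
              ∎

        part : ∀ w → Constant (average R (φ w))
        part Fin.zero = Constant-resp (λ x → sym (average-constant R φ₀-constant x)) φ₀-constant
        part w@(Fin.suc v) with toℕ w ℕ.≤? length T
        ... | yes w≤t = Constant-resp (λ x → sym (T-0 aR (φ-vanishes w (s≤s z≤n) w≤t) x)) (λ _ _ → refl)
        ... | no w≰t  = Constant-resp (λ x → sym (high w (ℕ.≰⇒> w≰t) x)) (λ _ _ → refl)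

-- The complex numbers

open Spectral ℂ-commutativeRing using (fromℤ; IsAlgebraicDesign) renaming (fromℕ to fromℕᶜ)

seq-≃ : ∀ {x y} → (∀ k → seq x k ≡ seq y k) → x ≃ y
seq-≃ {x} {y} e = mk≃ λ ε → let N , h = cauchy x ε in
  N , λ m k N≤m N≤k → ≡.subst (λ z → ℚ.∣ seq x m ℚ.- z ∣ ℚ.≤ ε) (e k) (h m k N≤m N≤k)

-- Copies the recursion of the embedding of ℕ into ℂ, whose real parts are these constants, so that
-- inverses can be taken in ℚ.
natural : ℕ → ℚ
natural zero    = 0ℚ
natural (suc n) = 1ℚ ℚ.+ natural n

natural-pos : ∀ n → ℚ.Positive (natural (suc n))
natural-pos zero    = _
natural-pos (suc n) = ℚ.pos+pos⇒pos 1ℚ (natural (suc n)) {{natural-pos n}}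

natural-nonZero : ∀ n → ℚ.NonZero (natural (suc n))
natural-nonZero n = ℚ.pos⇒nonZero (natural (suc n)) {{natural-pos n}}

re-fromℕ : ∀ n k → seq (re (fromℕᶜ n)) k ≡ natural n
re-fromℕ zero    k = ≡.refl
re-fromℕ (suc n) k = ≡.cong (1ℚ ℚ.+_) (re-fromℕ n k)

im-fromℕ : ∀ n k → seq (im (fromℕᶜ n)) k ≡ 0ℚ
im-fromℕ zero    k = ≡.refl
im-fromℕ (suc n) k = ≡.cong (0ℚ ℚ.+_) (im-fromℕ n k)

ℂ-inv : ℕ → ℂ
-- A default value: `*-inv` constrains positive arguments only.
ℂ-inv zero    = 0ᶜ
re (ℂ-inv (suc n)) = fromℚ (ℚ.1/_ (natural (suc n)) {{natural-nonZero n}})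
im (ℂ-inv (suc n)) = fromℚ 0ℚ

ℂ-*-inv : ∀ n → 1 ≤ n → fromℕᶜ n *ᶜ ℂ-inv n ≈ᶜ 1ᶜ
ℂ-*-inv (suc n) _ = seq-≃ real , seq-≃ imaginary
  where
  r : ℚ
  r = ℚ.1/_ (natural (suc n)) {{natural-nonZero n}}

  real : ∀ k → seq (re (fromℕᶜ (suc n) *ᶜ ℂ-inv (suc n))) k ≡ 1ℚ
  real k rewrite re-fromℕ n k | im-fromℕ n k | ℚ.*-inverseʳ (natural (suc n)) {{natural-nonZero n}} = ≡.refl

  imaginary : ∀ k → seq (im (fromℕᶜ (suc n) *ᶜ ℂ-inv (suc n))) k ≡ 0ℚ
  imaginary k rewrite re-fromℕ n k | im-fromℕ n k | ℚ.*-zeroʳ (natural (suc n)) | ℚ.*-zeroˡ r = ≡.refl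

ℂ-1≉0 : ¬ 1ᶜ ≈ᶜ 0ᶜ
-- At tolerance ½, closeness of the constant sequences 1 and 0 would give 1 ≤ ½, which computation
-- refutes.
ℂ-1≉0 (p , _) = let N , h = close p ½ in
  toWitnessFalse {a? = 1ℚ ℚ.≤? ½} _ (h N N ℕ.≤-refl ℕ.≤-refl)

ℂ-isRationalAlgebra : IsRationalAlgebra ℂ-commutativeRing
ℂ-isRationalAlgebra = record { inv = ℂ-inv ; *-inv = ℂ-*-inv ; 1≉0 = ℂ-1≉0 }

lcm-pos : ∀ m n → 1 ≤ m → 1 ≤ n → 1 ≤ lcm m n
lcm-pos m n 1≤m 1≤n = ℕ.n≢0⇒n>0 λ lcm≡0 → ℕ.m<n⇒n≢0 (ℕ.*-mono-≤ 1≤m 1≤n)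
  (≡.trans (≡.sym (gcd*lcm m n)) (≡.trans (≡.cong (gcd m n ℕ.*_) lcm≡0) (ℕ.*-zeroʳ (gcd m n))))

lcms-pos : ∀ {n} {q : Vec ℕ n} → All (2 ≤_) q → 1 ≤ lcms q
lcms-pos []                         = s≤s z≤n
lcms-pos {q = m Vec.∷ q} (2≤m ∷ 2≤q) = lcm-pos m (lcms q) (ℕ.<⇒≤ 2≤m) (lcms-pos 2≤q)

theorem7 : (n : ℕ) → 1 ≤ n → (q : Vec ℕ n) → All (2 ≤_) q → (t : ℕ) → t ≤ n →
    (C : Multiset (Word q)) → NonEmpty C →
    IsOrthogonalArray q t C ⇔ IsAlgebraicDesign (H q) (λ w → fromℤ (eigenvalue q w)) t C
theorem7 n _ q 2≤q t t≤n C _ = mk⇔ (orthogonal⇒design C t≤n) (design⇒orthogonal C)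
  where open Hamming ℂ-commutativeRing ℂ-isRationalAlgebra q (λ i → ℕ.<⇒≤ (lookup⁺ 2≤q i)) (lcms-pos 2≤q)
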